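{- Let $q$ be an indeterminate, let $f(q,z)=\sum_{n\geq0}\frac{(-1)^nz^n}{q^{\binom{n}{2}}(q;q)_n}\in\mathbb{Q}(q)[[z]]$ and $h(q,z)=\log f(q,z)$. Then $$h(q,z)=\sum_{n\geq1}\frac{(-1)^{n-1}P_{n}(q)}{n\, q^{\binom{n}{2}}(q^n-1)}z^n,$$ where each $P_{n}\in\mathbb{Z}[x]$ is a polynomial with $\deg P_{n}=\binom{n}{2}$, and $P_{dn}(\omega_d)=\binom{2n-1}{n-1}$ for all positive integers $d,n$ and every primitive $d$-th root of unity $\omega_d$.
   Context: $(q;q)_n=\prod_{i=1}^n(1-q^i)$. The logarithm is the formal logarithm of a power series in $z$ with constant term $1$. -}

module Defs where

open import Level using (0ℓ)
open import Data.Nat as ℕ using (ℕ; zero; suc; _∸_; _<_)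
open import Data.Nat.Combinatorics using (_C_)
open import Data.Integer as ℤ using (ℤ; +_; -[1+_])
open import Data.Rational as ℚ using (ℚ; 0ℚ; 1ℚ)
open import Data.List using (List; []; _∷_; map)
open import Data.Product using (_×_)
open import Data.Sum using (_⊎_)
open import Relation.Nullary using (¬_)
open import Relation.Binary.PropositionalEquality using (_≡_)
open import Algebra.Bundles using (CommutativeRing)

-- Polynomials in q over ℚ: coefficient lists, lowest degree first.

Poly : Set
Poly = List ℚ

coeff : Poly → ℕ → ℚ
coeff []       _       = 0ℚ
coeff (a ∷ p)  zero    = a
coeff (a ∷ p)  (suc i) = coeff p i

-- semantic equality of polynomials (trailing zeros irrelevant)
_≈ₚ_ : Poly → Poly → Set
p ≈ₚ r = ∀ i → coeff p i ≡ coeff r i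

_+ₚ_ : Poly → Poly → Poly
[]      +ₚ r       = r
(a ∷ p) +ₚ []      = a ∷ p
(a ∷ p) +ₚ (b ∷ r) = (a ℚ.+ b) ∷ (p +ₚ r)

scaleₚ : ℚ → Poly → Poly
scaleₚ c p = map (c ℚ.*_) p

_*ₚ_ : Poly → Poly → Poly
[]      *ₚ r = []
(a ∷ p) *ₚ r = scaleₚ a r +ₚ (0ℚ ∷ (p *ₚ r))

constₚ : ℚ → Poly
constₚ c = c ∷ []

Xpow : ℕ → Poly
Xpow zero    = 1ℚ ∷ []
Xpow (suc k) = 0ℚ ∷ Xpow k

natℚ : ℕ → ℚ
natℚ n = (+ n) ℚ./ 1

signℚ : ℕ → ℚ
signℚ zero    = 1ℚ
signℚ (suc n) = ℚ.- signℚ n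

qPoch : ℕ → Poly
qPoch zero    = constₚ 1ℚ
qPoch (suc n) = qPoch n *ₚ (constₚ 1ℚ +ₚ scaleₚ (ℚ.- 1ℚ) (Xpow (suc n)))

-- Elements of ℚ(q) as fractions num/den of polynomials (den ≠ 0 for all
-- fractions constructed below); equality by cross multiplication.

record Frac : Set where
  constructor _⁄_
  field
    num : Poly
    den : Poly
open Frac public

_≈F_ : Frac → Frac → Set
x ≈F y = (num x *ₚ den y) ≈ₚ (num y *ₚ den x)

zeroF oneF : Frac
zeroF = [] ⁄ constₚ 1ℚ
oneF  = constₚ 1ℚ ⁄ constₚ 1ℚ

_+F_ : Frac → Frac → Frac
x +F y = ((num x *ₚ den y) +ₚ (num y *ₚ den x)) ⁄ (den x *ₚ den y)

_*F_ : Frac → Frac → Frac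
x *F y = (num x *ₚ num y) ⁄ (den x *ₚ den y)

sumF : ℕ → (ℕ → Frac) → Frac
sumF zero    t = zeroF
sumF (suc n) t = sumF n t +F t n

Series : Set
Series = ℕ → Frac

_*S_ : Series → Series → Series
(a *S b) n = sumF (suc n) (λ i → a i *F b (n ∸ i))

oneS : Series
oneS zero    = oneF
oneS (suc n) = zeroF

_^S_ : Series → ℕ → Series
a ^S zero  = oneS
a ^S suc k = a *S (a ^S k)

-- formal logarithm of a series with constant term 1:
--   log F = Σ_{k≥1} (-1)^{k-1} (F - 1)^k / k .
-- Since F - 1 has zero constant term, only k ≤ n contribute to z^n.
logS : Series → Series
logS F n = sumF n (λ j → let k = suc j in
             ((constₚ (signℚ j) ⁄ constₚ (natℚ k)) *F ((G ^S k) n)))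
  where
  G : Series
  G zero    = zeroF
  G (suc m) = F (suc m)

fSeries : Series
fSeries n = constₚ (signℚ n) ⁄ (Xpow (n C 2) *ₚ qPoch n)

hSeries : Series
hSeries = logS fSeries

PolyZ : Set
PolyZ = List ℤ

coeffZ : PolyZ → ℕ → ℤ
coeffZ []      _       = + 0
coeffZ (a ∷ p) zero    = a
coeffZ (a ∷ p) (suc i) = coeffZ p i

HasDegree : PolyZ → ℕ → Set
HasDegree p m = ¬ (coeffZ p m ≡ + 0) × (∀ i → m < i → coeffZ p i ≡ + 0)

toℚPoly : PolyZ → Poly
toℚPoly p = map (λ a → a ℚ./ 1) p

claimedCoeff : PolyZ → ℕ → Frac
claimedCoeff P n =
  scaleₚ (signℚ (n ∸ 1)) (toℚPoly P)
  ⁄ (scaleₚ (natℚ n) (Xpow (n C 2)) *ₚ (Xpow n +ₚ constₚ (ℚ.- 1ℚ)))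

module _ (R : CommutativeRing 0ℓ 0ℓ) where
  open CommutativeRing R

  natR : ℕ → Carrier
  natR zero    = 0#
  natR (suc n) = 1# + natR n

  intR : ℤ → Carrier
  intR (+ n)     = natR n
  intR -[1+ n ]  = - natR (suc n)

  powR : Carrier → ℕ → Carrier
  powR x zero    = 1#
  powR x (suc k) = x * powR x k

  evalZ : PolyZ → Carrier → Carrier
  evalZ []      x = 0#
  evalZ (a ∷ p) x = intR a + x * evalZ p x

  IsCharZeroDomain : Set
  IsCharZeroDomain =
    (∀ x y → x * y ≈ 0# → x ≈ 0# ⊎ y ≈ 0#) × (∀ m → ¬ (natR (suc m) ≈ 0#))

  IsPrimitiveRoot : ℕ → Carrier → Set
  IsPrimitiveRoot d ω =
    (powR ω d ≈ 1#) × (∀ k → 0 < k → k < d → ¬ (powR ω k ≈ 1#))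

{-# OPTIONS --safe #-}
module Submission where

-- Put p = 1/q. Dividing the functional equation f(qz) = f(z) + z f(pz) by f(z) shows that f(z)/f(qz) = C(-z), where
-- C = 1 + z C(z) C(pz) is Carlitz's q-Catalan series, so that h is read off from the logarithm of C. With D = z d/dz the
-- logarithmic derivative L = DC/C equals C D(z C(pz)), which has coefficients in ℕ[p] given by an explicit convolution;
-- reversing them (multiplying by q^(n choose 2)) gives P_n, monic of degree n choose 2.
--
-- If p is a primitive d-th root of unity, Π = C(z)C(pz)⋯C(p^(d-1)z) is the inverse of an eigenvalue of a product of d
-- transfer matrices whose determinant is W = p^(d choose 2) z^d and whose trace is invariant under z ↦ pz and of degree
-- less than d, hence equal to 1. So Π = 1 + WΠ², the Catalan equation, and taking logarithms gives central binomials.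
--
-- The identity in ℚ(q) is checked at the points q = 2, 3, 4, …, where everything takes place in the field ℚ.

-- With E(z) = f(z)/f(qz) one has f(pz)/f(z) = E(pz), so the functional equation becomes 1/E(z) = 1
-- + zE(pz): Carlitz's equation with the sign of z changed. Applying D log to E compares Dh at z and
-- at qz and gives n(q^n - 1)h_n = (-1)^(n-1) L_n; this is where the denominator q^n - 1 comes from.
--
-- The coefficients of f have poles at roots of unity, so f cannot be specialised there. C and L
-- can: they make sense over every commutative ring with pq = 1. They are therefore built from
-- explicit polynomials and used twice, over ℚ for the identity in ℚ(q) and over the ring that
-- contains the root of unity.
--
-- The transfer matrices express C(z) = 1/(1 - zC(pz)) as a Möbius transformation; after d of them
-- the argument is back at z. D log Π is the sum of L(pⁱz) over i < d, whose coefficient at an index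
-- md is d times that of L, so nothing is lost there by passing from C to Π. The binomials are
-- reached through a first-order differential equation, which amounts to a two-term recursion.

open import Defs
open import Level using (0ℓ)
open import Data.Nat as ℕ using (ℕ; zero; suc; z≤n; s≤s; _!)
import Data.Nat.Properties as ℕₚ
open import Data.Nat.Combinatorics using (_C_; nCk+nC[k+1]≡[n+1]C[k+1]; nC1≡n; nCk≡nC[n∸k]; k![n∸k]!∣n!; nCk≡n!/k![n-k]!)
import Data.Nat.Coprimality as Coprime
open import Data.Nat.DivMod using (m/n*n≡m)
open import Data.Nat.Solver using (module +-*-Solver)
open import Data.Integer as ℤ using (ℤ) renaming (+_ to pos)
import Data.Integer.Properties as ℤₚ
open import Data.Rational as ℚ using (ℚ; 0ℚ; 1ℚ; mkℚ)
import Data.Rational.Properties as ℚₚ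
open import Data.List using (List; []; _∷_; map; length)
open import Data.Maybe.Base using (Maybe; just; nothing)
open import Data.Empty using (⊥-elim)
open import Data.Product using (Σ; _×_; _,_; proj₁; proj₂)
open import Data.Sum using (_⊎_; inj₁; inj₂)
open import Function using (_∘_)
open import Relation.Nullary using (yes; no)
open import Relation.Binary.PropositionalEquality as ≡ using (_≡_; _≢_)
import Relation.Binary.Reasoning.Setoid as Setoid-Reasoning
open import Algebra.Bundles using (CommutativeRing; RawRing)

-- Coefficients (a , b) stand for a - b; unlike ℤ, they map to a ring without case analysis on signs.
module DifferenceSolver (R : CommutativeRing 0ℓ 0ℓ) where
  open CommutativeRing R
  open import Algebra.Solver.Ring.AlmostCommutativeRing
  open import Algebra.Properties.Semiring.Mult.TCOptimised semiring using (×-homo-+; ×1-homo-*)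
    renaming (_×_ to _×′_)
  open import Algebra.Properties.Ring ring using (x[y-z]≈xy-xz; [y-z]x≈yx-zx)
  open import Algebra.Properties.AbelianGroup +-abelianGroup using (⁻¹-anti-homo‿-; ⁻¹-∙-comm)
  open import Algebra.Properties.Group +-group using (ε⁻¹≈ε)
  open import Algebra.Properties.CommutativeSemigroup +-commutativeSemigroup using (interchange; xy∙z≈xz∙y)
  open import Relation.Binary.Reasoning.Setoid setoid

  reduce : ℕ × ℕ → ℕ × ℕ
  reduce (suc a , suc b) = reduce (a , b)
  reduce x               = x

  differences : RawRing 0ℓ 0ℓ
  differences = record
    { Carrier = ℕ × ℕ
    ; _≈_ = _≡_
    ; _+_ = λ (a , b) (c , d) → reduce (a ℕ.+ c , b ℕ.+ d)
    ; _*_ = λ (a , b) (c , d) → reduce (a ℕ.* c ℕ.+ b ℕ.* d , a ℕ.* d ℕ.+ b ℕ.* c)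
    ; -_ = λ (a , b) → b , a
    ; 0# = 0 , 0
    ; 1# = 1 , 0
    }

  module 𝔻 = RawRing differences

  private
    ν : ℕ → Carrier
    ν n = n ×′ 1#

    ν-+ : ∀ m n → ν (m ℕ.+ n) ≈ ν m + ν n
    ν-+ = ×-homo-+ 1#

  -- The separate clause for a zero second component makes `0 , 0` and `1 , 0` reduce to `0#` and
  -- `1#`, so that `:0` and `:1` match the goals definitionally.
  ⟦_⟧ᵈ : ℕ × ℕ → Carrier
  ⟦ a , zero ⟧ᵈ  = ν a
  ⟦ a , suc b ⟧ᵈ = ν a - ν (suc b)

  private
    unfold : ∀ x → ⟦ x ⟧ᵈ ≈ ν (proj₁ x) - ν (proj₂ x)
    unfold (a , zero)  = sym (trans (+-congˡ ε⁻¹≈ε) (+-identityʳ _))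
    unfold (a , suc b) = refl

    sub-cong : ∀ {x x' y y'} → x ≈ x' → y ≈ y' → x - y ≈ x' - y'
    sub-cong p q = +-cong p (-‿cong q)

    ν-cross : ∀ a b c d → a ℕ.+ d ≡ c ℕ.+ b → ν a - ν b ≈ ν c - ν d
    ν-cross a b c d e = begin
      ν a - ν b                    ≈⟨ +-congʳ (pad (ν a) (ν d)) ⟨
      ((ν a + ν d) - ν d) - ν b    ≈⟨ xy∙z≈xz∙y _ _ _ ⟩
      ((ν a + ν d) - ν b) - ν d    ≈⟨ +-congʳ (+-congʳ (trans (sym (ν-+ a d)) (trans (reflexive (≡.cong ν e)) (ν-+ c b)))) ⟩
      ((ν c + ν b) - ν b) - ν d    ≈⟨ +-congʳ (pad (ν c) (ν b)) ⟩
      ν c - ν d                    ∎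
      where
      pad : ∀ u v → (u + v) - v ≈ u
      pad u v = trans (+-assoc _ _ _) (trans (+-congˡ (-‿inverseʳ v)) (+-identityʳ u))

    reduce-cross : ∀ a b → proj₁ (reduce (a , b)) ℕ.+ b ≡ a ℕ.+ proj₂ (reduce (a , b))
    reduce-cross zero    b       = ≡.refl
    reduce-cross (suc a) zero    = ≡.refl
    reduce-cross (suc a) (suc b) = ≡.trans (ℕₚ.+-suc _ b) (≡.cong suc (reduce-cross a b))

    unfold-reduce : ∀ a b → ⟦ reduce (a , b) ⟧ᵈ ≈ ν a - ν b
    unfold-reduce a b = trans (unfold (reduce (a , b))) (ν-cross _ _ a b (reduce-cross a b))

    +-hom : ∀ x y → ⟦ x 𝔻.+ y ⟧ᵈ ≈ ⟦ x ⟧ᵈ + ⟦ y ⟧ᵈ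
    +-hom x@(a , b) y@(c , d) = begin
      ⟦ x 𝔻.+ y ⟧ᵈ                     ≈⟨ unfold-reduce (a ℕ.+ c) (b ℕ.+ d) ⟩
      ν (a ℕ.+ c) - ν (b ℕ.+ d)         ≈⟨ sub-cong (ν-+ a c) (ν-+ b d) ⟩
      (ν a + ν c) - (ν b + ν d)         ≈⟨ +-congˡ (⁻¹-∙-comm _ _) ⟨
      (ν a + ν c) + (- ν b + - ν d)     ≈⟨ interchange _ _ _ _ ⟩
      (ν a - ν b) + (ν c - ν d)         ≈⟨ +-cong (unfold x) (unfold y) ⟨
      ⟦ x ⟧ᵈ + ⟦ y ⟧ᵈ                   ∎

    -hom : ∀ x → ⟦ 𝔻.- x ⟧ᵈ ≈ - ⟦ x ⟧ᵈ
    -hom x@(a , b) = begin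
      ⟦ b , a ⟧ᵈ    ≈⟨ unfold (b , a) ⟩
      ν b - ν a     ≈⟨ ⁻¹-anti-homo‿- _ _ ⟨
      - (ν a - ν b) ≈⟨ -‿cong (unfold x) ⟨
      - ⟦ x ⟧ᵈ      ∎

    ν-sum : ∀ a b c d → ν (a ℕ.* b ℕ.+ c ℕ.* d) ≈ ν a * ν b + ν c * ν d
    ν-sum a b c d = trans (ν-+ (a ℕ.* b) (c ℕ.* d)) (+-cong (×1-homo-* a b) (×1-homo-* c d))

    *-hom : ∀ x y → ⟦ x 𝔻.* y ⟧ᵈ ≈ ⟦ x ⟧ᵈ * ⟦ y ⟧ᵈ
    *-hom x@(a , b) y@(c , d) = begin
      ⟦ x 𝔻.* y ⟧ᵈ ≈⟨ unfold-reduce (a ℕ.* c ℕ.+ b ℕ.* d) (a ℕ.* d ℕ.+ b ℕ.* c) ⟩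
      _ ≈⟨ sub-cong (ν-sum a c b d) (ν-sum a d b c) ⟩
      (ν a * ν c + ν b * ν d) - (ν a * ν d + ν b * ν c)      ≈⟨ +-congˡ (⁻¹-∙-comm _ _) ⟨
      (ν a * ν c + ν b * ν d) + (- (ν a * ν d) + - (ν b * ν c)) ≈⟨ +-congˡ (+-comm _ _) ⟩
      (ν a * ν c + ν b * ν d) + (- (ν b * ν c) + - (ν a * ν d)) ≈⟨ interchange _ _ _ _ ⟩
      (ν a * ν c - ν b * ν c) + (ν b * ν d - ν a * ν d)      ≈⟨ +-congˡ (⁻¹-anti-homo‿- _ _) ⟨
      (ν a * ν c - ν b * ν c) - (ν a * ν d - ν b * ν d)      ≈⟨ sub-cong ([y-z]x≈yx-zx _ _ _) ([y-z]x≈yx-zx _ _ _) ⟨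
      (ν a - ν b) * ν c - (ν a - ν b) * ν d                  ≈⟨ x[y-z]≈xy-xz _ _ _ ⟨
      (ν a - ν b) * (ν c - ν d)                              ≈⟨ *-cong (unfold x) (unfold y) ⟨
      ⟦ x ⟧ᵈ * ⟦ y ⟧ᵈ ∎

    equal? : ∀ x y → Maybe (⟦ x ⟧ᵈ ≈ ⟦ y ⟧ᵈ)
    equal? x@(a , b) y@(c , d) with a ℕ.+ d ℕₚ.≟ c ℕ.+ b
    ... | no _  = nothing
    ... | yes e = just (trans (unfold x) (trans (ν-cross a b c d e) (sym (unfold y))))

    morphism : differences -Raw-AlmostCommutative⟶ fromCommutativeRing R
    morphism = record
      { ⟦_⟧ = ⟦_⟧ᵈ ; +-homo = +-hom ; *-homo = *-hom ; -‿homo = -hom ; 0-homo = refl ; 1-homo = refl }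

  open import Algebra.Solver.Ring differences (fromCommutativeRing R) morphism equal? public
    using (solve; _:=_; _:+_; _:*_; _:-_; :-_; con; Polynomial)

  :0 :1 : ∀ {n} → Polynomial n
  :0 = con (0 , 0)
  :1 = con (1 , 0)

-- Powers, natural multiples and finite sums in a commutative ring

module PowersAndMultiples (R : CommutativeRing 0ℓ 0ℓ) where
  open CommutativeRing R
  open DifferenceSolver R
  open import Algebra.Properties.Group +-group using (x∙y⁻¹≈ε⇒x≈y)
  open import Relation.Binary.Reasoning.Setoid setoid

  nat : ℕ → Carrier
  nat = natR R

  x-y≈0⇒x≈y : ∀ {x y} → x - y ≈ 0# → x ≈ y
  x-y≈0⇒x≈y = x∙y⁻¹≈ε⇒x≈y _ _

  pow : Carrier → ℕ → Carrier
  pow = powR R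

  nat-+ : ∀ m n → nat (m ℕ.+ n) ≈ nat m + nat n
  nat-+ zero    n = sym (+-identityˡ _)
  nat-+ (suc m) n = trans (+-congˡ (nat-+ m n)) (sym (+-assoc _ _ _))

  nat-* : ∀ m n → nat (m ℕ.* n) ≈ nat m * nat n
  nat-* zero    n = sym (zeroˡ _)
  nat-* (suc m) n = begin
    nat (n ℕ.+ m ℕ.* n)       ≈⟨ nat-+ n (m ℕ.* n) ⟩
    nat n + nat (m ℕ.* n)     ≈⟨ +-congˡ (nat-* m n) ⟩
    nat n + nat m * nat n     ≈⟨ solve 2 (λ x y → y :+ x :* y := (:1 :+ x) :* y) refl _ _ ⟩
    nat (suc m) * nat n       ∎

  nat-1 : nat 1 ≈ 1#
  nat-1 = +-identityʳ 1#

  pow-cong : ∀ {x y} n → x ≈ y → pow x n ≈ pow y n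
  pow-cong zero    e = refl
  pow-cong (suc n) e = *-cong e (pow-cong n e)

  pow-+ : ∀ x m n → pow x (m ℕ.+ n) ≈ pow x m * pow x n
  pow-+ x zero    n = sym (*-identityˡ _)
  pow-+ x (suc m) n = trans (*-congˡ (pow-+ x m n)) (sym (*-assoc _ _ _))

  pow-distrib : ∀ x y n → pow (x * y) n ≈ pow x n * pow y n
  pow-distrib x y zero    = sym (*-identityˡ _)
  pow-distrib x y (suc n) = trans (*-congˡ (pow-distrib x y n))
    (solve 4 (λ x y a b → (x :* y) :* (a :* b) := (x :* a) :* (y :* b)) refl _ _ _ _)

  pow-1 : ∀ n → pow 1# n ≈ 1#
  pow-1 zero    = refl
  pow-1 (suc n) = trans (*-identityˡ _) (pow-1 n)

  pow-* : ∀ x m n → pow x (m ℕ.* n) ≈ pow (pow x n) m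
  pow-* x zero    n = refl
  pow-* x (suc m) n = trans (pow-+ x n (m ℕ.* n)) (*-congˡ (pow-* x m n))

  pow-inverse : ∀ {x y} → x * y ≈ 1# → ∀ n → pow x n * pow y n ≈ 1#
  pow-inverse e n = trans (sym (pow-distrib _ _ n)) (trans (pow-cong n e) (pow-1 n))

  pow-multiple : ∀ {x d} → pow x d ≈ 1# → ∀ m → pow x (m ℕ.* d) ≈ 1#
  pow-multiple e m = trans (pow-* _ m _) (trans (pow-cong m e) (pow-1 m))

antidiagonal : {A : Set} → (A → A → A) → (ℕ → ℕ → A) → ℕ → A
antidiagonal _+_ φ zero    = φ 0 0
antidiagonal _+_ φ (suc n) = φ 0 (suc n) + antidiagonal _+_ (λ i j → φ (suc i) j) n

-- The relation may join two different types, so the same induction covers congruence in a ring,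
-- evaluation of polynomials and degree bounds. The equation `i + j ≡ n` supplies the bounds on `i`
-- and `j` that recursion on fuel requires.
antidiagonal-cong : {A B : Set} (_~_ : A → B → Set) {_+_ : A → A → A} {_∙_ : B → B → B}
  → (∀ {a b c d} → a ~ b → c ~ d → (a + c) ~ (b ∙ d))
  → ∀ {φ : ℕ → ℕ → A} {ψ : ℕ → ℕ → B} n
  → (∀ i j → i ℕ.+ j ≡ n → φ i j ~ ψ i j)
  → antidiagonal _+_ φ n ~ antidiagonal _∙_ ψ n
antidiagonal-cong _~_ +-cong zero    h = h 0 0 ≡.refl
antidiagonal-cong _~_ +-cong (suc n) h = +-cong (h 0 (suc n) ≡.refl)
  (antidiagonal-cong _~_ +-cong n (λ i j e → h (suc i) j (≡.cong suc e)))

module FiniteSums (R : CommutativeRing 0ℓ 0ℓ) where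
  open CommutativeRing R
  open DifferenceSolver R
  open PowersAndMultiples R

  sum : ℕ → (ℕ → Carrier) → Carrier
  sum zero    t = 0#
  sum (suc n) t = sum n t + t n

  sum-cong : ∀ n {s t} → (∀ j → s j ≈ t j) → sum n s ≈ sum n t
  sum-cong zero    h = refl
  sum-cong (suc n) h = +-cong (sum-cong n h) (h n)

  sum-*ˡ : ∀ k n t → k * sum n t ≈ sum n (λ j → k * t j)
  sum-*ˡ k zero    t = zeroʳ k
  sum-*ˡ k (suc n) t = trans (distribˡ _ _ _) (+-congʳ (sum-*ˡ k n t))

  sum-extend : ∀ {m n} t → m ℕ.≤ n → (∀ j → m ℕ.≤ j → t j ≈ 0#) → sum n t ≈ sum m t
  sum-extend {m} {n} t m≤n h with ℕₚ.m≤n⇒m<n∨m≡n m≤n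
  ... | inj₂ ≡.refl = refl
  sum-extend {m} {suc n} t _ h | inj₁ (s≤s m≤n) = trans (+-cong (sum-extend t m≤n h) (h n m≤n)) (+-identityʳ _)

  sum-constant : ∀ n k → sum n (λ _ → k) ≈ nat n * k
  sum-constant zero    k = sym (zeroˡ k)
  sum-constant (suc n) k = trans (+-congʳ (sum-constant n k))
    (solve 2 (λ n k → n :* k :+ k := (:1 :+ n) :* k) refl _ _)

  sum-head : ∀ n t → sum (suc n) t ≈ t 0 + sum n (λ j → t (suc j))
  sum-head zero    t = +-comm _ _
  sum-head (suc n) t = trans (+-congʳ (sum-head n t)) (+-assoc _ _ _)

  antidiagonal≈sum : ∀ (φ : ℕ → ℕ → Carrier) n → antidiagonal _+_ φ n ≈ sum (suc n) (λ i → φ i (n ℕ.∸ i))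
  antidiagonal≈sum φ zero    = sym (+-identityˡ _)
  antidiagonal≈sum φ (suc n) = trans (+-congˡ (antidiagonal≈sum (λ i j → φ (suc i) j) n))
    (sym (sum-head (suc n) (λ i → φ i (suc n ℕ.∸ i))))

  antidiagonal-*ˡ : ∀ k φ n → k * antidiagonal _+_ φ n ≈ antidiagonal _+_ (λ i j → k * φ i j) n
  antidiagonal-*ˡ k φ zero    = refl
  antidiagonal-*ˡ k φ (suc n) = trans (distribˡ _ _ _) (+-congˡ (antidiagonal-*ˡ k (λ i j → φ (suc i) j) n))

  sign : ℕ → Carrier
  sign zero    = 1#
  sign (suc n) = - sign n

  pow-neg1 : ∀ n → pow (- 1#) n ≈ sign n
  pow-neg1 zero    = refl
  pow-neg1 (suc n) = trans (*-congˡ (pow-neg1 n)) (solve 1 (λ x → :- :1 :* x := :- x) refl _)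

  alternating-geometric : ∀ N x g → sum N (λ j → sign j * (pow x j * g)) * (1# + x) + sign N * (pow x N * g) ≈ g
  alternating-geometric zero    x g = solve 2 (λ x g → :0 :* (:1 :+ x) :+ :1 :* (:1 :* g) := g) refl x g
  alternating-geometric (suc N) x g = trans
    (solve 5 (λ u s P x g → (u :+ s :* (P :* g)) :* (:1 :+ x) :+ :- s :* ((x :* P) :* g)
                          := u :* (:1 :+ x) :+ s :* (P :* g)) refl _ _ _ _ _)
    (alternating-geometric N x g)

-- Formal power series

module PowerSeries (R : CommutativeRing 0ℓ 0ℓ) where
  open CommutativeRing R
  open DifferenceSolver R
  open PowersAndMultiples R
  open import Relation.Binary.Reasoning.Setoid setoid

  Ser : Set
  Ser = ℕ → Carrier

  infix 4 _≋_
  infixl 6 _⊕_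
  infixl 7 _⊛_ _•_
  infix 8 ⊖_

  -- A record, so that unification can recover both series from the type of an equation; a bare
  -- pointwise statement would unfold to coefficients.
  record _≋_ (a b : Ser) : Set where
    constructor pointwise
    field at : ∀ n → a n ≈ b n
  open _≋_ public

  _⊕_ _⊛_ : Ser → Ser → Ser
  (a ⊕ b) n = a n + b n
  (a ⊛ b) n = antidiagonal _+_ (λ i j → a i * b j) n

  ⊖_ : Ser → Ser
  (⊖ a) n = - a n

  _•_ : Carrier → Ser → Ser
  (k • a) n = k * a n

  const : Carrier → Ser
  const k zero    = k
  const k (suc n) = 0#

  tail shift : Ser → Ser
  tail a n = a (suc n)

  shift a zero    = 0#
  shift a (suc n) = a n

  ⊛-local : ∀ {a a' b b'} n → (∀ i → i ℕ.≤ n → a i ≈ a' i) → (∀ i → i ℕ.≤ n → b i ≈ b' i)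
    → (a ⊛ b) n ≈ (a' ⊛ b') n
  ⊛-local n p q = antidiagonal-cong _≈_ +-cong n
    (λ { i j ≡.refl → *-cong (p i (ℕₚ.m≤m+n i j)) (q j (ℕₚ.m≤n+m j i)) })

  ⊛-cong : ∀ {a a' b b'} → a ≋ a' → b ≋ b' → a ⊛ b ≋ a' ⊛ b'
  ⊛-cong p q .at n = ⊛-local n (λ i _ → p .at i) (λ i _ → q .at i)

  ⊛-distribʳ : ∀ a b c → (b ⊕ c) ⊛ a ≋ (b ⊛ a) ⊕ (c ⊛ a)
  ⊛-distribʳ a b c .at zero    = distribʳ _ _ _
  ⊛-distribʳ a b c .at (suc n) = trans (+-cong (distribʳ _ _ _) (⊛-distribʳ a (tail b) (tail c) .at n))
    (solve 4 (λ x y u v → (x :+ y) :+ (u :+ v) := (x :+ u) :+ (y :+ v)) refl _ _ _ _)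

  •-⊛ : ∀ k a b → (k • a) ⊛ b ≋ k • (a ⊛ b)
  •-⊛ k a b .at zero    = *-assoc _ _ _
  •-⊛ k a b .at (suc n) = trans (+-cong (*-assoc _ _ _) (•-⊛ k (tail a) b .at n)) (sym (distribˡ _ _ _))

  ⊛-assoc : ∀ a b c → (a ⊛ b) ⊛ c ≋ a ⊛ (b ⊛ c)
  ⊛-assoc a b c .at zero    = *-assoc _ _ _
  ⊛-assoc a b c .at (suc n) = begin
    a 0 * b 0 * c (suc n) + (((a 0 • tail b) ⊕ (tail a ⊛ b)) ⊛ c) n
      ≈⟨ +-congˡ (⊛-distribʳ c (a 0 • tail b) (tail a ⊛ b) .at n) ⟩
    a 0 * b 0 * c (suc n) + (((a 0 • tail b) ⊛ c) n + ((tail a ⊛ b) ⊛ c) n)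
      ≈⟨ +-congˡ (+-cong (•-⊛ (a 0) (tail b) c .at n) (⊛-assoc (tail a) b c .at n)) ⟩
    a 0 * b 0 * c (suc n) + (a 0 * (tail b ⊛ c) n + (tail a ⊛ (b ⊛ c)) n)
      ≈⟨ solve 5 (λ x y u v w → x :* y :* u :+ (x :* v :+ w) := x :* (y :* u :+ v) :+ w) refl _ _ _ _ _ ⟩
    a 0 * (b 0 * c (suc n) + (tail b ⊛ c) n) + (tail a ⊛ (b ⊛ c)) n ∎

  ⊛-peelʳ : ∀ a b n → (a ⊛ b) (suc n) ≈ (a ⊛ tail b) n + a (suc n) * b 0
  ⊛-peelʳ a b zero    = refl
  ⊛-peelʳ a b (suc n) = trans (+-congˡ (⊛-peelʳ (tail a) b n)) (sym (+-assoc _ _ _))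

  ⊛-comm : ∀ a b → a ⊛ b ≋ b ⊛ a
  ⊛-comm a b .at zero    = *-comm _ _
  ⊛-comm a b .at (suc n) = begin
    a 0 * b (suc n) + (tail a ⊛ b) n   ≈⟨ +-cong (*-comm _ _) (⊛-comm (tail a) b .at n) ⟩
    b (suc n) * a 0 + (b ⊛ tail a) n   ≈⟨ +-comm _ _ ⟩
    (b ⊛ tail a) n + b (suc n) * a 0   ≈⟨ ⊛-peelʳ b a n ⟨
    (b ⊛ a) (suc n)                    ∎

  ⊛-zero-prefix : ∀ {a} b n → (∀ i → i ℕ.≤ n → a i ≈ 0#) → (a ⊛ b) n ≈ 0#
  ⊛-zero-prefix b zero    h = trans (*-congʳ (h 0 z≤n)) (zeroˡ _)
  ⊛-zero-prefix b (suc n) h = trans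
    (+-cong (trans (*-congʳ (h 0 z≤n)) (zeroˡ _)) (⊛-zero-prefix b n (λ i i≤n → h (suc i) (s≤s i≤n))))
    (+-identityʳ _)

  const-⊛ : ∀ k a → const k ⊛ a ≋ k • a
  const-⊛ k a .at zero    = refl
  const-⊛ k a .at (suc n) = trans (+-congˡ (⊛-zero-prefix a n (λ _ _ → refl))) (+-identityʳ _)

  seriesRing : CommutativeRing 0ℓ 0ℓ
  seriesRing = record
    { Carrier = Ser ; _≈_ = _≋_ ; _+_ = _⊕_ ; _*_ = _⊛_ ; -_ = ⊖_ ; 0# = λ _ → 0# ; 1# = const 1#
    ; isCommutativeRing = record
      { isRing = record
        { +-isAbelianGroup = record
          { isGroup = record
              { isMonoid = record
                { isSemigroup = record
                  { isMagma = record
                    { isEquivalence = record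
                      { refl = pointwise λ n → refl
                      ; sym = λ e → pointwise λ n → sym (e .at n)
                      ; trans = λ e f → pointwise λ n → trans (e .at n) (f .at n) }
                    ; ∙-cong = λ e f → pointwise λ n → +-cong (e .at n) (f .at n) }
                  ; assoc = λ a b c → pointwise λ n → +-assoc _ _ _ }
                ; identity = (λ a → pointwise λ n → +-identityˡ _) , (λ a → pointwise λ n → +-identityʳ _) }
              ; inverse = (λ a → pointwise λ n → -‿inverseˡ _) , (λ a → pointwise λ n → -‿inverseʳ _)
              ; ⁻¹-cong = λ e → pointwise λ n → -‿cong (e .at n) }
            ; comm = λ a b → pointwise λ n → +-comm _ _ }
        ; *-cong = ⊛-cong
        ; *-assoc = ⊛-assoc
        ; *-identity = ⊛-identityˡ , λ a → pointwise λ n → trans (⊛-comm a (const 1#) .at n) (⊛-identityˡ a .at n)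
        ; distrib = (λ a b c → pointwise λ n → trans (⊛-comm a (b ⊕ c) .at n)
                      (trans (⊛-distribʳ a b c .at n) (+-cong (⊛-comm b a .at n) (⊛-comm c a .at n))))
                  , ⊛-distribʳ }
      ; *-comm = ⊛-comm } }
    where
    ⊛-identityˡ : ∀ a → const 1# ⊛ a ≋ a
    ⊛-identityˡ a .at n = trans (const-⊛ 1# a .at n) (*-identityˡ _)

  module 𝕊 = CommutativeRing seriesRing

  Z : Ser
  Z = shift (const 1#)

  shift-⊛ : ∀ a b → shift a ⊛ b ≋ shift (a ⊛ b)
  shift-⊛ a b .at zero    = zeroˡ _
  shift-⊛ a b .at (suc n) = trans (+-congʳ (zeroˡ _)) (+-identityˡ _)

  shift-cong : ∀ {a b} → a ≋ b → shift a ≋ shift b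
  shift-cong e .at zero    = refl
  shift-cong e .at (suc n) = e .at n

  Z-⊛ : ∀ a → Z ⊛ a ≋ shift a
  Z-⊛ a = 𝕊.trans (shift-⊛ (const 1#) a) (shift-cong (𝕊.*-identityˡ a))

  -- Replaces division by `f`. Once the coefficients of `a` up to `n` vanish, the coefficient of
  -- `a ⊛ f` at `suc n` is just `a (suc n) * f 0`; zero divisors in the ring do no harm since `f 0`
  -- is 1.
  ⊛-cancelʳ-unit : ∀ a f → f 0 ≈ 1# → a ⊛ f ≋ 𝕊.0# → a ≋ 𝕊.0#
  ⊛-cancelʳ-unit a f f₀ e .at n = below n n ℕₚ.≤-refl
    where
    times-f₀ : ∀ x → x * f 0 ≈ 0# → x ≈ 0#
    times-f₀ x h = trans (sym (trans (*-congˡ f₀) (*-identityʳ x))) h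

    below : ∀ n i → i ℕ.≤ n → a i ≈ 0#
    below zero    .0 z≤n = times-f₀ (a 0) (e .at 0)
    below (suc n) i i≤ with ℕₚ.m≤n⇒m<n∨m≡n i≤
    ... | inj₁ (s≤s i≤n) = below n i i≤n
    ... | inj₂ ≡.refl = times-f₀ (a (suc n)) (begin
      a (suc n) * f 0                      ≈⟨ +-identityˡ _ ⟨
      0# + a (suc n) * f 0                 ≈⟨ +-congʳ (⊛-zero-prefix (tail f) n (below n)) ⟨
      (a ⊛ tail f) n + a (suc n) * f 0     ≈⟨ ⊛-peelʳ a f n ⟨
      (a ⊛ f) (suc n)                      ≈⟨ e .at (suc n) ⟩
      0#                                   ∎)

  -- σ c a is a(cz) and D is z d/dz.
  σ : Carrier → Ser → Ser
  σ c a n = pow c n * a n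

  D : Ser → Ser
  D a n = nat n * a n

  σ-cong : ∀ c {a b} → a ≋ b → σ c a ≋ σ c b
  σ-cong c e .at n = *-congˡ (e .at n)

  D-cong : ∀ {a b} → a ≋ b → D a ≋ D b
  D-cong e .at n = *-congˡ (e .at n)

  σ-⊕ : ∀ c a b → σ c (a ⊕ b) ≋ σ c a ⊕ σ c b
  σ-⊕ c a b .at n = distribˡ _ _ _

  σ-⊖ : ∀ c a → σ c (⊖ a) ≋ ⊖ σ c a
  σ-⊖ c a .at n = solve 2 (λ x y → x :* :- y := :- (x :* y)) refl _ _

  D-⊕ : ∀ a b → D (a ⊕ b) ≋ D a ⊕ D b
  D-⊕ a b .at n = distribˡ _ _ _

  σ-⊛ : ∀ c a b → σ c (a ⊛ b) ≋ σ c a ⊛ σ c b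
  σ-⊛ c a b .at zero    = solve 2 (λ x y → :1 :* (x :* y) := (:1 :* x) :* (:1 :* y)) refl _ _
  σ-⊛ c a b .at (suc n) = begin
    c * pow c n * (a 0 * b (suc n) + (tail a ⊛ b) n)
      ≈⟨ solve 5 (λ c q x y u → c :* q :* (x :* y :+ u) := (:1 :* x) :* (c :* q :* y) :+ c :* (q :* u)) refl _ _ _ _ _ ⟩
    1# * a 0 * (c * pow c n * b (suc n)) + c * σ c (tail a ⊛ b) n
      ≈⟨ +-congˡ (trans (*-congˡ (σ-⊛ c (tail a) b .at n)) (sym (•-⊛ c (σ c (tail a)) (σ c b) .at n))) ⟩
    1# * a 0 * (c * pow c n * b (suc n)) + ((c • σ c (tail a)) ⊛ σ c b) n
      ≈⟨ +-congˡ (⊛-cong (pointwise λ i → sym (*-assoc _ _ _)) 𝕊.refl .at n) ⟩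
    1# * a 0 * (c * pow c n * b (suc n)) + (tail (σ c a) ⊛ σ c b) n ∎

  -- Induction through `tail`, which lowers every index by one: `tail (D a)` is
  -- `tail a ⊕ D (tail a)`, and this accounts for the extra summand `(tail a ⊛ b) n`.
  D-⊛ : ∀ a b → D (a ⊛ b) ≋ (D a ⊛ b) ⊕ (a ⊛ D b)
  D-⊛ a b .at zero    = solve 2 (λ x y → :0 :* (x :* y) := (:0 :* x) :* y :+ x :* (:0 :* y)) refl _ _
  D-⊛ a b .at (suc n) = begin
    (1# + nat n) * (a 0 * b (suc n) + (tail a ⊛ b) n)
      ≈⟨ solve 4 (λ k x y u → (:1 :+ k) :* (x :* y :+ u) := x :* ((:1 :+ k) :* y) :+ (u :+ k :* u)) refl _ _ _ _ ⟩
    a 0 * D b (suc n) + ((tail a ⊛ b) n + D (tail a ⊛ b) n)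
      ≈⟨ +-congˡ (+-congˡ (D-⊛ (tail a) b .at n)) ⟩
    a 0 * D b (suc n) + ((tail a ⊛ b) n + ((D (tail a) ⊛ b) n + (tail a ⊛ D b) n))
      ≈⟨ solve 5 (λ x y u v w → y :+ (u :+ (v :+ w)) := ((:0 :* x) :* v :+ (u :+ v)) :+ (y :+ w)) refl (a 0) _ _ _ _ ⟩
    ((0# * a 0) * (D (tail a) ⊛ b) n + ((tail a ⊛ b) n + (D (tail a) ⊛ b) n)) + (a 0 * D b (suc n) + (tail a ⊛ D b) n)
      ≈⟨ +-congʳ (+-cong (trans (*-congʳ (zeroˡ _)) (trans (zeroˡ _) (sym (trans (*-congʳ (zeroˡ _)) (zeroˡ _)))))
           (sym (⊛-distribʳ b (tail a) (D (tail a)) .at n))) ⟩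
    ((0# * a 0) * b (suc n) + ((tail a ⊕ D (tail a)) ⊛ b) n) + (a 0 * D b (suc n) + (tail a ⊛ D b) n)
      ≈⟨ +-congʳ (+-congˡ (⊛-cong (pointwise λ i → solve 2 (λ k x → x :+ k :* x := (:1 :+ k) :* x) refl _ _) 𝕊.refl .at n)) ⟩
    ((0# * a 0) * b (suc n) + (tail (D a) ⊛ b) n) + (a 0 * D b (suc n) + (tail a ⊛ D b) n) ∎

  σ-D : ∀ c a → σ c (D a) ≋ D (σ c a)
  σ-D c a .at n = solve 3 (λ x y z → x :* (y :* z) := y :* (x :* z)) refl _ _ _

  σ-σ : ∀ c c' a → σ c (σ c' a) ≋ σ (c * c') a
  σ-σ c c' a .at n = trans (sym (*-assoc _ _ _)) (*-congʳ (sym (pow-distrib c c' n)))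

  σ-comm : ∀ c c' a → σ c (σ c' a) ≋ σ c' (σ c a)
  σ-comm c c' a .at n = solve 3 (λ x y z → x :* (y :* z) := y :* (x :* z)) refl _ _ _

  σ-1 : ∀ {c} a → c ≈ 1# → σ c a ≋ a
  σ-1 a e .at n = trans (*-congʳ (trans (pow-cong n e) (pow-1 n))) (*-identityˡ _)

  σ-const : ∀ c k → σ c (const k) ≋ const k
  σ-const c k .at zero    = *-identityˡ _
  σ-const c k .at (suc n) = zeroʳ _

  D-const : ∀ k → D (const k) ≋ 𝕊.0#
  D-const k .at zero    = zeroˡ _
  D-const k .at (suc n) = zeroʳ _

  σ-shift : ∀ c a → σ c (shift a) ≋ c • shift (σ c a)
  σ-shift c a .at zero    = trans (zeroʳ _) (sym (zeroʳ _))
  σ-shift c a .at (suc n) = *-assoc _ _ _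

-- The polynomials P_n

T : ℕ → ℕ
T zero    = 0
T (suc n) = n ℕ.+ T n

C2≡T : ∀ n → n C 2 ≡ T n
C2≡T zero    = ≡.refl
C2≡T (suc n) = ≡.trans (≡.sym (nCk+nC[k+1]≡[n+1]C[k+1] n 1)) (≡.cong₂ ℕ._+_ (nC1≡n n) (C2≡T n))

T-+ : ∀ m n → T (m ℕ.+ n) ≡ T m ℕ.+ T n ℕ.+ m ℕ.* n
T-+ zero    n = ≡.sym (ℕₚ.+-identityʳ _)
T-+ (suc m) n = ≡.trans (≡.cong (m ℕ.+ n ℕ.+_) (T-+ m n))
  (+-*-Solver.solve 4 (λ m n a b → m :+ n :+ (a :+ b :+ m :* n) := m :+ a :+ b :+ (n :+ m :* n)) ≡.refl m n (T m) (T n))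
  where open +-*-Solver

-- The source of the exponent `j * suc i` in `carlitz`. Clearing the summand p^i c_i c_j of
-- Carlitz's recursion by q^T(i+j+1) spends `i` on p^i and `T i`, `T j` on the two factors;
-- q^(j(i+1)) is left over.
T-split : ∀ i j → T (suc (i ℕ.+ j)) ≡ i ℕ.+ (T i ℕ.+ T j) ℕ.+ j ℕ.* suc i
T-split i j = ≡.trans (≡.cong (i ℕ.+ j ℕ.+_) (T-+ i j))
  (+-*-Solver.solve 4 (λ m n a b → m :+ n :+ (a :+ b :+ m :* n) := m :+ (a :+ b) :+ (n :* (con 1 :+ m))) ≡.refl i j (T i) (T j))
  where open +-*-Solver

-- Modulo `d` only `m * T d` survives, so a `d`-th root of unity raised to `T (m * d)` depends on
-- its power `T d` alone.
T-* : ∀ d m → T (m ℕ.* d) ≡ m ℕ.* T d ℕ.+ (d ℕ.* T m) ℕ.* d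
T-* d zero    = ≡.sym (≡.cong (ℕ._* d) (ℕₚ.*-zeroʳ d))
T-* d (suc m) = ≡.trans (T-+ d (m ℕ.* d)) (≡.trans (≡.cong (λ x → T d ℕ.+ x ℕ.+ d ℕ.* (m ℕ.* d)) (T-* d m))
  (+-*-Solver.solve 4 (λ d m a b → a :+ (m :* a :+ (d :* b) :* d) :+ d :* (m :* d) := (a :+ m :* a) :+ (d :* (m :+ b)) :* d) ≡.refl d m (T d) (T m)))
  where open +-*-Solver

PolyN : Set
PolyN = List ℕ

infixl 6 _+ₙ_
infixl 7 _*ₙ_

_+ₙ_ : PolyN → PolyN → PolyN
[]      +ₙ r       = r
(a ∷ p) +ₙ []      = a ∷ p
(a ∷ p) +ₙ (b ∷ r) = (a ℕ.+ b) ∷ (p +ₙ r)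

scaleₙ : ℕ → PolyN → PolyN
scaleₙ c = map (c ℕ.*_)

_*ₙ_ : PolyN → PolyN → PolyN
[]      *ₙ r = []
(a ∷ p) *ₙ r = scaleₙ a r +ₙ (0 ∷ (p *ₙ r))

X^_·_ : ℕ → PolyN → PolyN
X^ zero  · p = p
X^ suc k · p = 0 ∷ (X^ k · p)

-- Carlitz's q-Catalan numbers c_n(1/q), cleared of denominators: carlitz n = q^(n choose 2) c_n(1/q).
-- The first argument of carlitzUpTo is fuel.
carlitzUpTo : ℕ → ℕ → PolyN
carlitzUpTo zero    n       = []
carlitzUpTo (suc k) zero    = 1 ∷ []
carlitzUpTo (suc k) (suc n) = antidiagonal _+ₙ_
  (λ i j → X^ (j ℕ.* suc i) · (carlitzUpTo k i *ₙ carlitzUpTo k j)) n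

carlitz : ℕ → PolyN
carlitz n = carlitzUpTo (suc n) n

carlitzUpTo-fuel : ∀ k k' {n} → n ℕ.< k → n ℕ.< k' → carlitzUpTo k n ≡ carlitzUpTo k' n
carlitzUpTo-fuel (suc k) (suc k') {zero}  _ _ = ≡.refl
carlitzUpTo-fuel (suc k) (suc k') {suc n} (s≤s n<k) (s≤s n<k') =
  antidiagonal-cong _≡_ (≡.cong₂ _+ₙ_) n (λ { i j ≡.refl →
    ≡.cong (X^ (j ℕ.* suc i) ·_) (≡.cong₂ _*ₙ_
      (carlitzUpTo-fuel k k' (ℕₚ.≤-<-trans (ℕₚ.m≤m+n i j) n<k) (ℕₚ.≤-<-trans (ℕₚ.m≤m+n i j) n<k'))
      (carlitzUpTo-fuel k k' (ℕₚ.≤-<-trans (ℕₚ.m≤n+m j i) n<k) (ℕₚ.≤-<-trans (ℕₚ.m≤n+m j i) n<k'))) })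

carlitz-suc : ∀ n → carlitz (suc n) ≡
  antidiagonal _+ₙ_ (λ i j → X^ (j ℕ.* suc i) · (carlitz i *ₙ carlitz j)) n
carlitz-suc n = antidiagonal-cong _≡_ (≡.cong₂ _+ₙ_) n (λ { i j ≡.refl →
  ≡.cong (X^ (j ℕ.* suc i) ·_) (≡.cong₂ _*ₙ_
    (carlitzUpTo-fuel (suc (i ℕ.+ j)) (suc i) (s≤s (ℕₚ.m≤m+n i j)) ℕₚ.≤-refl)
    (carlitzUpTo-fuel (suc (i ℕ.+ j)) (suc j) (s≤s (ℕₚ.m≤n+m j i)) ℕₚ.≤-refl)) })

-- These are the P_n: the coefficients of D(zC(pz)) · C, cleared in the same way as `carlitz`, with
-- the factor `suc i` produced by D. The value at 0 is the vanishing constant term of a logarithmic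
-- derivative.
logCarlitz : ℕ → PolyN
logCarlitz zero    = []
logCarlitz (suc n) = antidiagonal _+ₙ_
  (λ i j → X^ (j ℕ.* suc i) · scaleₙ (suc i) (carlitz i *ₙ carlitz j)) n

coeffₙ : PolyN → ℕ → ℕ
coeffₙ []      _       = 0
coeffₙ (a ∷ p) zero    = a
coeffₙ (a ∷ p) (suc i) = coeffₙ p i

-- The degree is at most m and the coefficient of X^m is a, which may be 0.
record Top (m : ℕ) (p : PolyN) (a : ℕ) : Set where
  constructor _,_
  field
    leading : coeffₙ p m ≡ a
    above   : ∀ i → m ℕ.< i → coeffₙ p i ≡ 0

coeffₙ-+ : ∀ p r i → coeffₙ (p +ₙ r) i ≡ coeffₙ p i ℕ.+ coeffₙ r i
coeffₙ-+ []      r       i       = ≡.refl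
coeffₙ-+ (a ∷ p) []      i       = ≡.sym (ℕₚ.+-identityʳ _)
coeffₙ-+ (a ∷ p) (b ∷ r) zero    = ≡.refl
coeffₙ-+ (a ∷ p) (b ∷ r) (suc i) = coeffₙ-+ p r i

coeffₙ-scale : ∀ c p i → coeffₙ (scaleₙ c p) i ≡ c ℕ.* coeffₙ p i
coeffₙ-scale c []      i       = ≡.sym (ℕₚ.*-zeroʳ c)
coeffₙ-scale c (a ∷ p) zero    = ≡.refl
coeffₙ-scale c (a ∷ p) (suc i) = coeffₙ-scale c p i

Top-+ : ∀ {m p r a b} → Top m p a → Top m r b → Top m (p +ₙ r) (a ℕ.+ b)
Top-+ {m} {p} {r} (e , z) (e' , z') = ≡.trans (coeffₙ-+ p r m) (≡.cong₂ ℕ._+_ e e') ,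
  λ i m<i → ≡.trans (coeffₙ-+ p r i) (≡.cong₂ ℕ._+_ (z i m<i) (z' i m<i))

Top-scale : ∀ {m p a} c → Top m p a → Top m (scaleₙ c p) (c ℕ.* a)
Top-scale {m} {p} c (e , z) = ≡.trans (coeffₙ-scale c p m) (≡.cong (c ℕ.*_) e) ,
  λ i m<i → ≡.trans (coeffₙ-scale c p i) (≡.trans (≡.cong (c ℕ.*_) (z i m<i)) (ℕₚ.*-zeroʳ c))

Top-∷ : ∀ {m p a} c → Top m p a → Top (suc m) (c ∷ p) a
Top-∷ c (e , z) = e , λ { (suc i) (s≤s m<i) → z i m<i }

Top-X^ : ∀ {m p a} k → Top m p a → Top (k ℕ.+ m) (X^ k · p) a
Top-X^ zero    t = t
Top-X^ (suc k) t = Top-∷ 0 (Top-X^ k t)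

Top-raise : ∀ {m m' p a} → m ℕ.< m' → Top m p a → Top m' p 0
Top-raise m<m' (e , z) = z _ m<m' , λ i m'<i → z i (ℕₚ.<-trans m<m' m'<i)

coeffₙ-zero-* : ∀ p r → (∀ i → coeffₙ p i ≡ 0) → ∀ i → coeffₙ (p *ₙ r) i ≡ 0
coeffₙ-zero-* []      r h i = ≡.refl
coeffₙ-zero-* (a ∷ p) r h i = ≡.trans (coeffₙ-+ (scaleₙ a r) (0 ∷ (p *ₙ r)) i) (≡.cong₂ ℕ._+_
  (≡.trans (coeffₙ-scale a r i) (≡.cong (ℕ._* coeffₙ r i) (h 0)))
  (rest i))
  where
  rest : ∀ i → coeffₙ (0 ∷ (p *ₙ r)) i ≡ 0
  rest zero    = ≡.refl
  rest (suc i) = coeffₙ-zero-* p r (h ∘ suc) i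

Top-* : ∀ {m k b} p r {a} → Top m p a → Top k r b → Top (m ℕ.+ k) (p *ₙ r) (a ℕ.* b)
Top-* []      r (≡.refl , _) _ = ≡.refl , λ _ _ → ≡.refl
Top-* {zero} {k} {b} (a ∷ p) r (≡.refl , z) t = ≡.subst (Top k _) (ℕₚ.+-identityʳ (a ℕ.* b))
  (Top-+ (Top-scale a t) (shifted k , λ i _ → shifted i))
  where
  shifted : ∀ i → coeffₙ (0 ∷ (p *ₙ r)) i ≡ 0
  shifted zero    = ≡.refl
  shifted (suc i) = coeffₙ-zero-* p r (λ j → z (suc j) (s≤s z≤n)) i
Top-* {suc m} {k} {b} (a₀ ∷ p) r {a} (e , z) t =
  Top-+ (Top-raise (s≤s (ℕₚ.m≤n+m k m)) (Top-scale a₀ t))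
    (Top-∷ 0 (Top-* p r (e , λ i m<i → z (suc i) (s≤s m<i)) t))

-- Only the term i = 0 of the convolutions defining carlitz and logCarlitz reaches the top degree.
module _ where
  private
    indicator : ℕ → ℕ
    indicator zero    = 1
    indicator (suc _) = 0

    sum-indicator : ∀ n → antidiagonal ℕ._+_ (λ i j → indicator i) n ≡ 1
    sum-indicator zero    = ≡.refl
    sum-indicator (suc n) = ≡.cong suc (zeros n)
      where
      zeros : ∀ n → antidiagonal ℕ._+_ (λ i j → 0) n ≡ 0
      zeros zero    = ≡.refl
      zeros (suc n) = zeros n

    -- By `T-split` the degree `j * suc i + T i + T j` falls short of `T (suc (i + j))` by exactly
    -- `i`. The function `a` is constantly 1 for `carlitz` and `suc` for `logCarlitz`; in both cases
    -- the one surviving term contributes `a 0`, which is 1.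
    Top-term : ∀ (a : ℕ → ℕ) → a 0 ≡ 1 → ∀ i j {p} → Top (T i ℕ.+ T j) p (a i) →
      Top (T (suc (i ℕ.+ j))) (X^ (j ℕ.* suc i) · p) (indicator i)
    Top-term a a₀ zero j {p} t = ≡.subst₂ (λ m → Top m (X^ (j ℕ.* 1) · p))
      (≡.trans (ℕₚ.+-comm (j ℕ.* 1) (T j)) (≡.sym (T-split 0 j))) a₀ (Top-X^ (j ℕ.* 1) t)
    Top-term a a₀ (suc i) j t = Top-raise
      (≡.subst (suc (j ℕ.* suc (suc i) ℕ.+ (T (suc i) ℕ.+ T j)) ℕ.≤_) (≡.sym (T-split (suc i) j))
        (ℕₚ.≤-trans (ℕₚ.≤-reflexive (≡.cong suc (ℕₚ.+-comm (j ℕ.* suc (suc i)) _)))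
          (ℕₚ.+-monoˡ-≤ (j ℕ.* suc (suc i)) (s≤s (ℕₚ.m≤n+m _ i)))))
      (Top-X^ (j ℕ.* suc (suc i)) t)

    Top-sum : ∀ (a : ℕ → ℕ) → a 0 ≡ 1 → ∀ n (φ : ℕ → ℕ → PolyN) →
      (∀ i j → i ℕ.+ j ≡ n → Top (T i ℕ.+ T j) (φ i j) (a i)) →
      Top (T (suc n)) (antidiagonal _+ₙ_ (λ i j → X^ (j ℕ.* suc i) · φ i j) n) 1
    Top-sum a a₀ n φ h = ≡.subst (Top (T (suc n)) _) (sum-indicator n)
      (antidiagonal-cong (Top (T (suc n))) Top-+ {φ = λ i j → X^ (j ℕ.* suc i) · φ i j} n
        (λ { i j ≡.refl → Top-term a a₀ i j (h i j ≡.refl) }))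

  Top-carlitzUpTo : ∀ k n → n ℕ.< k → Top (T n) (carlitzUpTo k n) 1
  Top-carlitzUpTo (suc k) zero    _ = ≡.refl , λ { (suc i) _ → ≡.refl }
  Top-carlitzUpTo (suc k) (suc n) (s≤s n<k) = Top-sum (λ _ → 1) ≡.refl n (λ i j → carlitzUpTo k i *ₙ carlitzUpTo k j)
    (λ { i j ≡.refl → (Top-* (carlitzUpTo k i) (carlitzUpTo k j)
      (Top-carlitzUpTo k i (ℕₚ.≤-<-trans (ℕₚ.m≤m+n i j) n<k))
      (Top-carlitzUpTo k j (ℕₚ.≤-<-trans (ℕₚ.m≤n+m j i) n<k))) })

  Top-logCarlitz : ∀ n → Top (T (suc n)) (logCarlitz (suc n)) 1
  Top-logCarlitz n = Top-sum suc ≡.refl n (λ i j → scaleₙ (suc i) (carlitz i *ₙ carlitz j))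
    (λ i j _ → (≡.subst (Top (T i ℕ.+ T j) _) (ℕₚ.*-identityʳ (suc i))
      (Top-scale (suc i)
        (Top-* (carlitz i) (carlitz j) (Top-carlitzUpTo (suc i) i ℕₚ.≤-refl) (Top-carlitzUpTo (suc j) j ℕₚ.≤-refl)))))

toPolyZ : PolyN → PolyZ
toPolyZ = map pos

coeffZ-toPolyZ : ∀ p i → coeffZ (toPolyZ p) i ≡ pos (coeffₙ p i)
coeffZ-toPolyZ []      i       = ≡.refl
coeffZ-toPolyZ (a ∷ p) zero    = ≡.refl
coeffZ-toPolyZ (a ∷ p) (suc i) = coeffZ-toPolyZ p i

logCarlitz-degree : ∀ n → 1 ℕ.≤ n → HasDegree (toPolyZ (logCarlitz n)) (n C 2)
logCarlitz-degree (suc n) _ rewrite C2≡T (suc n) with Top-logCarlitz n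
... | (e , z) = (λ h → 1≢0 (≡.trans (≡.sym (≡.trans (coeffZ-toPolyZ p (T (suc n))) (≡.cong pos e))) h))
              , λ i m<i → ≡.trans (coeffZ-toPolyZ p i) (≡.cong pos (z i m<i))
  where
  p = logCarlitz (suc n)
  1≢0 : pos 1 ≡ pos 0 → _
  1≢0 ()

-- Evaluation of polynomials with natural coefficients

module Evaluation (R : CommutativeRing 0ℓ 0ℓ) (q : CommutativeRing.Carrier R) where
  open CommutativeRing R
  open DifferenceSolver R
  open PowersAndMultiples R
  open import Relation.Binary.Reasoning.Setoid setoid

  eval : PolyN → Carrier
  eval p = evalZ R (toPolyZ p) q

  eval-+ : ∀ p r → eval (p +ₙ r) ≈ eval p + eval r
  eval-+ []      r       = sym (+-identityˡ _)
  eval-+ (a ∷ p) []      = sym (+-identityʳ _)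
  eval-+ (a ∷ p) (b ∷ r) = trans (+-cong (nat-+ a b) (*-congˡ (eval-+ p r)))
    (solve 5 (λ a b x u v → a :+ b :+ x :* (u :+ v) := a :+ x :* u :+ (b :+ x :* v)) refl _ _ _ _ _)

  eval-scale : ∀ c p → eval (scaleₙ c p) ≈ nat c * eval p
  eval-scale c []      = sym (zeroʳ _)
  eval-scale c (a ∷ p) = trans (+-cong (nat-* c a) (*-congˡ (eval-scale c p)))
    (solve 4 (λ c a x u → c :* a :+ x :* (c :* u) := c :* (a :+ x :* u)) refl _ _ _ _)

  eval-* : ∀ p r → eval (p *ₙ r) ≈ eval p * eval r
  eval-* []      r = sym (zeroˡ _)
  eval-* (a ∷ p) r = begin
    eval (scaleₙ a r +ₙ (0 ∷ (p *ₙ r)))          ≈⟨ eval-+ (scaleₙ a r) (0 ∷ (p *ₙ r)) ⟩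
    eval (scaleₙ a r) + (0# + q * eval (p *ₙ r)) ≈⟨ +-cong (eval-scale a r) (+-congˡ (*-congˡ (eval-* p r))) ⟩
    nat a * eval r + (0# + q * (eval p * eval r))
      ≈⟨ solve 4 (λ a r x p → a :* r :+ (:0 :+ x :* (p :* r)) := (a :+ x :* p) :* r) refl _ _ _ _ ⟩
    (nat a + q * eval p) * eval r                ∎

  eval-X^ : ∀ k p → eval (X^ k · p) ≈ pow q k * eval p
  eval-X^ zero    p = sym (*-identityˡ _)
  eval-X^ (suc k) p = trans (+-identityˡ _) (trans (*-congˡ (eval-X^ k p)) (sym (*-assoc _ _ _)))

  eval-antidiagonal : ∀ {φ : ℕ → ℕ → PolyN} {ψ : ℕ → ℕ → Carrier} n →
    (∀ i j → i ℕ.+ j ≡ n → eval (φ i j) ≈ ψ i j) →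
    eval (antidiagonal _+ₙ_ φ n) ≈ antidiagonal _+_ ψ n
  eval-antidiagonal n h = antidiagonal-cong (λ p x → eval p ≈ x)
    (λ {p} e e' → trans (eval-+ p _) (+-cong e e')) n h

-- The Carlitz series and its logarithmic derivative

module CarlitzIdentities (K : CommutativeRing 0ℓ 0ℓ) where
  open CommutativeRing K
  open DifferenceSolver K
  open import Relation.Binary.Reasoning.Setoid setoid

  -- The first equation says that `c` is inverse to `1# - y`, and the second that `(1# - y) * c'` is
  -- `y' * c`; multiplying by `c` solves for `c'`. It is applied with `y` = zC(pz).
  derivative-of-fixpoint : ∀ {c y c' y'} → c ≈ 1# + y * c → c' ≈ y' * c + y * c' → c' ≈ (y' * c) * c
  derivative-of-fixpoint {c} {y} {c'} {y'} e e' = begin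
    c'                            ≈⟨ solve 3 (λ c y c' → c' := (:1 :+ y :* c :- y :* c) :* c') refl c y c' ⟩
    (1# + y * c - y * c) * c'     ≈⟨ *-congʳ (+-congʳ e) ⟨
    (c - y * c) * c'              ≈⟨ solve 3 (λ c y c' → (c :- y :* c) :* c' := c :* (c' :- y :* c')) refl c y c' ⟩
    c * (c' - y * c')             ≈⟨ *-congˡ (+-congʳ e') ⟩
    c * (y' * c + y * c' - y * c') ≈⟨ solve 4 (λ c y c' y' → c :* (y' :* c :+ y :* c' :- y :* c') := (y' :* c) :* c) refl c y c' y' ⟩
    (y' * c) * c                  ∎

module CarlitzSeries (R : CommutativeRing 0ℓ 0ℓ) (p q : CommutativeRing.Carrier R)
  (pq≈1 : CommutativeRing._≈_ R (CommutativeRing._*_ R p q) (CommutativeRing.1# R)) where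
  open CommutativeRing R
  open DifferenceSolver R
  open PowersAndMultiples R
  open PowerSeries R
  open FiniteSums R using (antidiagonal-*ˡ)
  open Evaluation R q
  open CarlitzIdentities seriesRing
  
  private module ≈-Reasoning = Setoid-Reasoning setoid
  private module ≋-Reasoning = Setoid-Reasoning 𝕊.setoid

  𝐂 L : Ser
  𝐂 n = pow p (T n) * eval (carlitz n)
  L n = pow p (T n) * eval (logCarlitz n)

  private
    T-weight : ∀ i j → pow p (T (suc (i ℕ.+ j))) * pow q (j ℕ.* suc i) ≈ pow p i * (pow p (T i) * pow p (T j))
    T-weight i j = let open ≈-Reasoning in begin
      pow p (T (suc (i ℕ.+ j))) * pow q (j ℕ.* suc i)
        ≈⟨ *-congʳ (reflexive (≡.cong (pow p) (T-split i j))) ⟩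
      pow p (i ℕ.+ (T i ℕ.+ T j) ℕ.+ j ℕ.* suc i) * pow q (j ℕ.* suc i)
        ≈⟨ *-congʳ (trans (pow-+ p (i ℕ.+ (T i ℕ.+ T j)) _) (*-congʳ (trans (pow-+ p i _) (*-congˡ (pow-+ p (T i) _))))) ⟩
      pow p i * (pow p (T i) * pow p (T j)) * pow p (j ℕ.* suc i) * pow q (j ℕ.* suc i)
        ≈⟨ *-assoc _ _ _ ⟩
      pow p i * (pow p (T i) * pow p (T j)) * (pow p (j ℕ.* suc i) * pow q (j ℕ.* suc i))
        ≈⟨ *-congˡ (pow-inverse pq≈1 (j ℕ.* suc i)) ⟩
      pow p i * (pow p (T i) * pow p (T j)) * 1#
        ≈⟨ *-identityʳ _ ⟩
      pow p i * (pow p (T i) * pow p (T j)) ∎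

  C-tail : tail 𝐂 ≋ σ p 𝐂 ⊛ 𝐂
  C-tail .at n = let open ≈-Reasoning in begin
    pow p (T (suc n)) * eval (carlitz (suc n))
      ≈⟨ *-congˡ (trans (reflexive (≡.cong eval (carlitz-suc n)))
           (eval-antidiagonal {ψ = λ i j → pow q (j ℕ.* suc i) * (eval (carlitz i) * eval (carlitz j))} n
             (λ i j _ → trans (eval-X^ (j ℕ.* suc i) _) (*-congˡ (eval-* (carlitz i) (carlitz j)))))) ⟩
    _ ≈⟨ antidiagonal-*ˡ (pow p (T (suc n))) _ n ⟩
    _ ≈⟨ antidiagonal-cong _≈_ +-cong n (λ { i j ≡.refl → trans (sym (*-assoc _ _ _)) (trans (*-congʳ (T-weight i j))
           (solve 5 (λ a b c x y → (a :* (b :* c)) :* (x :* y) := (a :* (b :* x)) :* (c :* y)) refl _ _ _ _ _)) }) ⟩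
    (σ p 𝐂 ⊛ 𝐂) n ∎

  C₀ : 𝐂 0 ≈ 1#
  C₀ = trans (*-identityˡ _) (trans (+-cong nat-1 (zeroʳ q)) (+-identityʳ _))

  C-fixpoint : 𝐂 ≋ const 1# ⊕ (shift (σ p 𝐂) ⊛ 𝐂)
  C-fixpoint .at zero    = trans C₀ (sym (trans (+-congˡ (zeroˡ _)) (+-identityʳ _)))
  C-fixpoint .at (suc n) = trans (C-tail .at n) (sym (trans (+-identityˡ _) (shift-⊛ (σ p 𝐂) 𝐂 .at (suc n))))

  L-explicit : L ≋ D (shift (σ p 𝐂)) ⊛ 𝐂
  L-explicit .at zero    = trans (zeroʳ _) (sym (trans (*-congʳ (zeroˡ _)) (zeroˡ _)))
  L-explicit .at (suc n) = let open ≈-Reasoning in begin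
    pow p (T (suc n)) * eval (logCarlitz (suc n))
      ≈⟨ *-congˡ (eval-antidiagonal
           {ψ = λ i j → pow q (j ℕ.* suc i) * (nat (suc i) * (eval (carlitz i) * eval (carlitz j)))} n
           (λ i j _ → trans (eval-X^ (j ℕ.* suc i) _) (*-congˡ
             (trans (eval-scale (suc i) (carlitz i *ₙ carlitz j)) (*-congˡ (eval-* (carlitz i) (carlitz j))))))) ⟩
    _ ≈⟨ antidiagonal-*ˡ (pow p (T (suc n))) _ n ⟩
    _ ≈⟨ antidiagonal-cong _≈_ +-cong n (λ { i j ≡.refl → trans (sym (*-assoc _ _ _)) (trans (*-congʳ (T-weight i j))
           (solve 6 (λ a b c k x y → (a :* (b :* c)) :* (k :* (x :* y)) := (k :* (a :* (b :* x))) :* (c :* y)) refl _ _ _ _ _ _)) }) ⟩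
    (tail (D (shift (σ p 𝐂))) ⊛ 𝐂) n
      ≈⟨ +-identityˡ _ ⟨
    0# + (tail (D (shift (σ p 𝐂))) ⊛ 𝐂) n
      ≈⟨ +-congʳ (trans (*-congʳ (zeroˡ _)) (zeroˡ _)) ⟨
    (D (shift (σ p 𝐂)) ⊛ 𝐂) (suc n) ∎

  D-C : D 𝐂 ≋ L ⊛ 𝐂
  D-C = 𝕊.trans (derivative-of-fixpoint C-fixpoint (let open ≋-Reasoning in begin
      D 𝐂                                        ≈⟨ D-cong C-fixpoint ⟩
      D (const 1# ⊕ Y ⊛ 𝐂)                       ≈⟨ D-⊕ (const 1#) (Y ⊛ 𝐂) ⟩
      D (const 1#) ⊕ D (Y ⊛ 𝐂)                   ≈⟨ 𝕊.+-congʳ (D-const 1#) ⟩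
      𝕊.0# ⊕ D (Y ⊛ 𝐂)                           ≈⟨ 𝕊.+-identityˡ _ ⟩
      D (Y ⊛ 𝐂)                                  ≈⟨ D-⊛ Y 𝐂 ⟩
      D Y ⊛ 𝐂 ⊕ Y ⊛ D 𝐂                          ∎))
    (𝕊.*-congʳ (𝕊.sym L-explicit))
    where
    Y = shift (σ p 𝐂)

-- The logarithm of f

module FormalLogarithm (R : CommutativeRing 0ℓ 0ℓ) (r : ℕ → CommutativeRing.Carrier R)
  (r-inverse : ∀ j → CommutativeRing._≈_ R (CommutativeRing._*_ R (r j) (natR R (suc j))) (CommutativeRing.1# R)) where
  open CommutativeRing R
  open DifferenceSolver R
  open PowersAndMultiples R
  open FiniteSums R
  open PowerSeries R
  private
    module Pow𝕊 = PowersAndMultiples seriesRing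
    module Sum𝕊 = FiniteSums seriesRing
    module S = DifferenceSolver seriesRing

  -- The truncation depends on the index `n`, as in `logS`: since `G` will have no constant term,
  -- higher powers do not reach index `n`.
  log1+ : Ser → Ser
  log1+ G n = sum n (λ j → (sign j * r j) * Pow𝕊.pow G (suc j) n)

  private
    const-+ : ∀ a b → const (a + b) ≋ const a ⊕ const b
    const-+ a b .at zero    = refl
    const-+ a b .at (suc n) = sym (+-identityˡ _)

    sum-at : ∀ N t n → Sum𝕊.sum N t n ≈ sum N (λ j → t j n)
    sum-at zero    t n = refl
    sum-at (suc N) t n = +-congʳ (sum-at N t n)

    sign-const : ∀ N → Sum𝕊.sign N ≋ const (sign N)
    sign-const zero    = 𝕊.refl
    sign-const (suc N) .at zero    = -‿cong (sign-const N .at 0)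
    sign-const (suc N) .at (suc n) = trans (-‿cong (sign-const N .at (suc n))) (solve 0 (:- :0 := :0) refl)

    sign-⊛ : ∀ N a → Sum𝕊.sign N ⊛ a ≋ sign N • a
    sign-⊛ N a = 𝕊.trans (𝕊.*-congʳ (sign-const N)) (const-⊛ (sign N) a)

    D-pow : ∀ G j → D (Pow𝕊.pow G (suc j)) ≋ const (nat (suc j)) ⊛ (Pow𝕊.pow G j ⊛ D G)
    D-pow G zero = begin
      D (G ⊛ const 1#)                 ≈⟨ D-cong (𝕊.*-identityʳ G) ⟩
      D G                              ≈⟨ 𝕊.*-identityˡ _ ⟨
      const 1# ⊛ D G                   ≈⟨ 𝕊.*-identityˡ _ ⟨
      const 1# ⊛ (const 1# ⊛ D G)      ≈⟨ 𝕊.*-congʳ (pointwise λ { zero → nat-1 ; (suc n) → refl }) ⟨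
      const (nat 1) ⊛ (const 1# ⊛ D G) ∎
      where open Setoid-Reasoning 𝕊.setoid
    D-pow G (suc j) = begin
      D (G ⊛ Gʲ⁺¹)                                          ≈⟨ D-⊛ G Gʲ⁺¹ ⟩
      D G ⊛ Gʲ⁺¹ ⊕ G ⊛ D Gʲ⁺¹                               ≈⟨ 𝕊.+-congˡ (𝕊.*-congˡ (D-pow G j)) ⟩
      D G ⊛ (G ⊛ Gʲ) ⊕ G ⊛ (const (nat (suc j)) ⊛ (Gʲ ⊛ D G))
        ≈⟨ S.solve 4 (λ g' g p k → g' S.:* (g S.:* p) S.:+ g S.:* (k S.:* (p S.:* g'))
             S.:= (S.:1 S.:+ k) S.:* ((g S.:* p) S.:* g')) 𝕊.refl (D G) G Gʲ (const (nat (suc j))) ⟩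
      (const 1# ⊕ const (nat (suc j))) ⊛ (Gʲ⁺¹ ⊛ D G)       ≈⟨ 𝕊.*-congʳ (const-+ 1# (nat (suc j))) ⟨
      const (nat (suc (suc j))) ⊛ (Gʲ⁺¹ ⊛ D G)              ∎
      where
      open Setoid-Reasoning 𝕊.setoid
      Gʲ = Pow𝕊.pow G j
      Gʲ⁺¹ = Pow𝕊.pow G (suc j)

    raise-order : ∀ a b {n} → b 0 ≈ 0# → (∀ i → i ℕ.≤ n → a i ≈ 0#) → ∀ i → i ℕ.≤ suc n → (b ⊛ a) i ≈ 0#
    raise-order a b b₀ h zero    _         = trans (*-congʳ b₀) (zeroˡ _)
    raise-order a b b₀ h (suc i) (s≤s i≤n) = trans
      (+-cong (trans (*-congʳ b₀) (zeroˡ _))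
        (trans (⊛-comm (tail b) a .at i) (⊛-zero-prefix (tail b) i (λ k k≤i → h k (ℕₚ.≤-trans k≤i i≤n)))))
      (+-identityʳ _)

    -- Each factor `G` raises the order by one and `D G` has no constant term itself, so the product
    -- starts only at index `suc j`.
    order : ∀ G → G 0 ≈ 0# → ∀ j i → i ℕ.≤ j → (Pow𝕊.pow G j ⊛ D G) i ≈ 0#
    order G G₀ zero    .0 z≤n = trans (*-congˡ (zeroˡ _)) (zeroʳ _)
    order G G₀ (suc j) i i≤j  = trans (𝕊.*-assoc G (Pow𝕊.pow G j) (D G) .at i)
      (raise-order (Pow𝕊.pow G j ⊛ D G) G G₀ (order G G₀ j) i i≤j)

  -- The index `n` is fixed first. Up to `n`, the series `D (log1+ G)` agrees with the sum
  -- `partial`, whose length no longer varies with the index; in `alternating-geometric` the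
  -- remainder contains `G` to the power `n` times `D G`, which vanishes at index `n`.
  D-log1+ : ∀ G → G 0 ≈ 0# → D (log1+ G) ⊛ (const 1# ⊕ G) ≋ D G
  D-log1+ G G₀ .at n = begin
    (D (log1+ G) ⊛ (const 1# ⊕ G)) n
      ≈⟨ ⊛-local {b = const 1# ⊕ G} n agrees (λ _ _ → refl) ⟩
    (partial ⊛ (const 1# ⊕ G)) n
      ≈⟨ +-identityʳ _ ⟨
    (partial ⊛ (const 1# ⊕ G)) n + 0#
      ≈⟨ +-congˡ (trans (sign-⊛ n (Pow𝕊.pow G n ⊛ D G) .at n) (trans (*-congˡ (order G G₀ n n ℕₚ.≤-refl)) (zeroʳ _))) ⟨
    (partial ⊛ (const 1# ⊕ G) ⊕ Sum𝕊.sign n ⊛ (Pow𝕊.pow G n ⊛ D G)) n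
      ≈⟨ Sum𝕊.alternating-geometric n G (D G) .at n ⟩
    D G n ∎
    where
    open Setoid-Reasoning setoid
    partial : Ser
    partial = Sum𝕊.sum n (λ j → Sum𝕊.sign j ⊛ (Pow𝕊.pow G j ⊛ D G))

    term : ∀ i j → nat i * ((sign j * r j) * Pow𝕊.pow G (suc j) i) ≈ sign j * (Pow𝕊.pow G j ⊛ D G) i
    term i j = begin
      nat i * ((sign j * r j) * Pow𝕊.pow G (suc j) i)
        ≈⟨ solve 4 (λ n s r x → n :* ((s :* r) :* x) := (s :* r) :* (n :* x)) refl _ _ _ _ ⟩
      (sign j * r j) * D (Pow𝕊.pow G (suc j)) i
        ≈⟨ *-congˡ (trans (D-pow G j .at i) (const-⊛ (nat (suc j)) _ .at i)) ⟩
      (sign j * r j) * (nat (suc j) * (Pow𝕊.pow G j ⊛ D G) i)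
        ≈⟨ solve 4 (λ s r n x → (s :* r) :* (n :* x) := (s :* (r :* n)) :* x) refl _ _ _ _ ⟩
      (sign j * (r j * nat (suc j))) * (Pow𝕊.pow G j ⊛ D G) i
        ≈⟨ *-congʳ (trans (*-congˡ (r-inverse j)) (*-identityʳ _)) ⟩
      sign j * (Pow𝕊.pow G j ⊛ D G) i ∎

    agrees : ∀ i → i ℕ.≤ n → D (log1+ G) i ≈ partial i
    agrees i i≤n = begin
      nat i * sum i (λ j → (sign j * r j) * Pow𝕊.pow G (suc j) i)   ≈⟨ sum-*ˡ (nat i) i _ ⟩
      sum i (λ j → nat i * ((sign j * r j) * Pow𝕊.pow G (suc j) i)) ≈⟨ sum-cong i (term i) ⟩
      sum i (λ j → sign j * (Pow𝕊.pow G j ⊛ D G) i)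
        ≈⟨ sum-extend _ i≤n (λ j i≤j → trans (*-congˡ (order G G₀ j i i≤j)) (zeroʳ _)) ⟨
      sum n (λ j → sign j * (Pow𝕊.pow G j ⊛ D G) i)
        ≈⟨ sum-cong n (λ j → sign-⊛ j (Pow𝕊.pow G j ⊛ D G) .at i) ⟨
      sum n (λ j → (Sum𝕊.sign j ⊛ (Pow𝕊.pow G j ⊛ D G)) i)          ≈⟨ sum-at n _ i ⟨
      partial i ∎

module QuotientIdentities (K : CommutativeRing 0ℓ 0ℓ) where
  open CommutativeRing K
  open DifferenceSolver K
  open import Relation.Binary.Reasoning.Setoid setoid

  -- Here E = C(-z), E' = E(pz), F = f(qz) and f' = f(pz). The defect `F * E - f` reappears on the
  -- right behind a factor z, once as itself and once, in `f * E' - f'`, with pz for z; that forces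
  -- all its coefficients to vanish in turn.
  quotient-defect : ∀ {z E E' F f f'} → E ≈ 1# + (- (z * E')) * E → F ≈ f + z * f' →
    F * E - f ≈ z * - ((f * E' - f') + (F * E - f) * E')
  quotient-defect {z} {E} {E'} {F} {f} {f'} e e' = begin
    F * E - f                                    ≈⟨ +-congʳ (*-congˡ e) ⟩
    F * (1# + (- (z * E')) * E) - f
      ≈⟨ solve 5 (λ z E E' F f → F :* (:1 :+ (:- (z :* E')) :* E) :- f := F :+ (F :* (:- (z :* E')) :* E :- f)) refl z E E' F f ⟩
    F + (F * (- (z * E')) * E - f)               ≈⟨ +-congʳ e' ⟩
    f + z * f' + (F * (- (z * E')) * E - f)
      ≈⟨ solve 6 (λ z E E' F f f' → f :+ z :* f' :+ (F :* (:- (z :* E')) :* E :- f)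
                    := z :* :- ((f :* E' :- f') :+ (F :* E :- f) :* E')) refl z E E' F f f' ⟩
    z * - ((f * E' - f') + (F * E - f) * E')     ∎

  -- `H` and `l` are the logarithmic derivatives of `F` and `E`, and `h` that of their product `f`;
  -- the factor `f` remains because it is cancelled only later, as a series with constant term 1.
  product-rule-quotient : ∀ {E F f h H l} → F * E ≈ f → h * f ≈ (H * F) * E + F * (l * E) → ((H + l) - h) * f ≈ 0#
  product-rule-quotient {E} {F} {f} {h} {H} {l} e e' = begin
    ((H + l) - h) * f       ≈⟨ solve 4 (λ H l h f → (H :+ l :- h) :* f := (H :+ l) :* f :- h :* f) refl H l h f ⟩
    (H + l) * f - h * f     ≈⟨ +-cong (*-congˡ (sym e)) (-‿cong e') ⟩
    (H + l) * (F * E) - ((H * F) * E + F * (l * E))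
      ≈⟨ solve 4 (λ H l F E → (H :+ l) :* (F :* E) :- ((H :* F) :* E :+ F :* (l :* E)) := :0) refl H l F E ⟩
    0# ∎

module LogarithmOfQuotient (R : CommutativeRing 0ℓ 0ℓ) (p q : CommutativeRing.Carrier R)
  (pq≈1 : CommutativeRing._≈_ R (CommutativeRing._*_ R p q) (CommutativeRing.1# R)) where
  open CommutativeRing R
  open DifferenceSolver R
  open PowersAndMultiples R
  open PowerSeries R
  open CarlitzSeries R p q pq≈1
  open QuotientIdentities seriesRing
  private
    module ≈-Reasoning = Setoid-Reasoning setoid
    module ≋-Reasoning = Setoid-Reasoning 𝕊.setoid

    E : Ser
    E = σ (- 1#) 𝐂

  private
    E-fixpoint : E ≋ const 1# ⊕ (⊖ (Z ⊛ σ p E)) ⊛ E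
    E-fixpoint = begin
      E                                               ≈⟨ σ-cong (- 1#) C-fixpoint ⟩
      σ (- 1#) (const 1# ⊕ shift (σ p 𝐂) ⊛ 𝐂)         ≈⟨ σ-⊕ (- 1#) _ _ ⟩
      σ (- 1#) (const 1#) ⊕ σ (- 1#) (shift (σ p 𝐂) ⊛ 𝐂)
        ≈⟨ 𝕊.+-cong (σ-const (- 1#) 1#) (σ-⊛ (- 1#) (shift (σ p 𝐂)) 𝐂) ⟩
      const 1# ⊕ σ (- 1#) (shift (σ p 𝐂)) ⊛ E         ≈⟨ 𝕊.+-congˡ (𝕊.*-congʳ (begin
        σ (- 1#) (shift (σ p 𝐂))      ≈⟨ σ-shift (- 1#) (σ p 𝐂) ⟩
        (- 1#) • shift (σ (- 1#) (σ p 𝐂)) ≈⟨ pointwise (λ n → solve 1 (λ x → :- :1 :* x := :- x) refl _) ⟩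
        ⊖ shift (σ (- 1#) (σ p 𝐂))    ≈⟨ 𝕊.-‿cong (shift-cong (σ-comm (- 1#) p 𝐂)) ⟩
        ⊖ shift (σ p E)               ≈⟨ 𝕊.-‿cong (Z-⊛ (σ p E)) ⟨
        ⊖ (Z ⊛ σ p E)                 ∎)) ⟩
      const 1# ⊕ (⊖ (Z ⊛ σ p E)) ⊛ E ∎
      where open ≋-Reasoning

    D-E : D E ≋ σ (- 1#) L ⊛ E
    D-E = begin
      D E                    ≈⟨ σ-D (- 1#) 𝐂 ⟨
      σ (- 1#) (D 𝐂)         ≈⟨ σ-cong (- 1#) D-C ⟩
      σ (- 1#) (L ⊛ 𝐂)       ≈⟨ σ-⊛ (- 1#) L 𝐂 ⟩
      σ (- 1#) L ⊛ E         ∎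
      where open ≋-Reasoning

  module _ (f : Ser) (f-equation : σ q f ≋ f ⊕ shift (σ p f)) where
    private
      defect : Ser
      defect = σ q f ⊛ E ⊕ ⊖ f

      -- Since pq = 1, substituting pz turns f(qz) back into f(z); hence the first bracket of
      -- `quotient-defect` is the defect at pz.
      σp-defect : σ p defect ≋ f ⊛ σ p E ⊕ ⊖ σ p f
      σp-defect = begin
        σ p defect                                    ≈⟨ σ-⊕ p _ _ ⟩
        σ p (σ q f ⊛ E) ⊕ σ p (⊖ f)                   ≈⟨ 𝕊.+-cong (σ-⊛ p (σ q f) E) (σ-⊖ p f) ⟩
        σ p (σ q f) ⊛ σ p E ⊕ ⊖ σ p f                 ≈⟨ 𝕊.+-congʳ (𝕊.*-congʳ (𝕊.trans (σ-σ p q f) (σ-1 f pq≈1))) ⟩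
        f ⊛ σ p E ⊕ ⊖ σ p f                           ∎
        where open ≋-Reasoning

      defect-recursion : defect ≋ shift (⊖ (σ p defect ⊕ defect ⊛ σ p E))
      defect-recursion = begin
        defect
          ≈⟨ quotient-defect {Z} {E} {σ p E} {σ q f} {f} {σ p f} E-fixpoint
               (𝕊.trans f-equation (𝕊.+-congˡ (𝕊.sym (Z-⊛ (σ p f))))) ⟩
        Z ⊛ ⊖ ((f ⊛ σ p E ⊕ ⊖ σ p f) ⊕ defect ⊛ σ p E) ≈⟨ Z-⊛ _ ⟩
        shift (⊖ ((f ⊛ σ p E ⊕ ⊖ σ p f) ⊕ defect ⊛ σ p E)) ≈⟨ shift-cong (𝕊.-‿cong (𝕊.+-congʳ σp-defect)) ⟨
        shift (⊖ (σ p defect ⊕ defect ⊛ σ p E)) ∎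
        where open ≋-Reasoning

      defect-below : ∀ n i → i ℕ.≤ n → defect i ≈ 0#
      defect-below n zero _ = defect-recursion .at 0
      defect-below (suc n) (suc i) (s≤s i≤n) = begin
        defect (suc i)                             ≈⟨ defect-recursion .at (suc i) ⟩
        - (pow p i * defect i + (defect ⊛ σ p E) i)
          ≈⟨ -‿cong (+-cong (*-congˡ (defect-below n i i≤n))
               (⊛-zero-prefix (σ p E) i (λ k k≤i → defect-below n k (ℕₚ.≤-trans k≤i i≤n)))) ⟩
        - (pow p i * 0# + 0#)                      ≈⟨ solve 1 (λ x → :- (x :* :0 :+ :0) := :0) refl _ ⟩
        0#                                         ∎
        where open ≈-Reasoning

    quotient : σ q f ⊛ σ (- 1#) 𝐂 ≋ f
    quotient = PowersAndMultiples.x-y≈0⇒x≈y seriesRing (pointwise λ n → defect-below n n ℕₚ.≤-refl)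

    -- At index n this reads (q^n - 1)H_n = (-1)^(n-1) L_n; the substitution -z in C(-z) gives the
    -- alternating sign.
    log-quotient : f 0 ≈ 1# → ∀ H → D f ≋ H ⊛ f → σ q H ⊕ σ (- 1#) L ≋ H
    log-quotient f₀ H Df = PowersAndMultiples.x-y≈0⇒x≈y seriesRing (⊛-cancelʳ-unit _ f f₀ (product-rule-quotient quotient (begin
        H ⊛ f                                   ≈⟨ Df ⟨
        D f                                     ≈⟨ D-cong quotient ⟨
        D (σ q f ⊛ E)                           ≈⟨ D-⊛ (σ q f) E ⟩
        D (σ q f) ⊛ E ⊕ σ q f ⊛ D E             ≈⟨ 𝕊.+-cong (𝕊.*-congʳ (begin
          D (σ q f)                   ≈⟨ σ-D q f ⟨
          σ q (D f)                   ≈⟨ σ-cong q Df ⟩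
          σ q (H ⊛ f)                 ≈⟨ σ-⊛ q H f ⟩
          σ q H ⊛ σ q f               ∎)) (𝕊.*-congˡ D-E) ⟩
        (σ q H ⊛ σ q f) ⊛ E ⊕ σ q f ⊛ (σ (- 1#) L ⊛ E) ∎)))
      where open ≋-Reasoning

-- Values at roots of unity

centralBinomial : ℕ → ℕ
centralBinomial m = (m ℕ.+ m) C m

centralBinomial-factorials : ∀ m → centralBinomial m ℕ.* (m ! ℕ.* m !) ≡ (m ℕ.+ m) !
centralBinomial-factorials m = ≡.trans
  (≡.cong (λ k → centralBinomial m ℕ.* (m ! ℕ.* k !)) (≡.sym (ℕₚ.m+n∸n≡m m m)))
  (≡.trans (≡.cong (ℕ._* (m ! ℕ.* (m ℕ.+ m ℕ.∸ m) !)) (nCk≡n!/k![n-k]! m≤2m))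
    (m/n*n≡m {{m ℕₚ.!* (m ℕ.+ m ℕ.∸ m) !≢0}} (k![n∸k]!∣n! m≤2m)))
  where
  m≤2m = ℕₚ.m≤m+n m m

-- This is the recursion that the differential equation for 1/√(1 - 4W) imposes. Both sides become
-- factorials after multiplication by (m+1) · m! · m!.
centralBinomial-suc : ∀ m → suc m ℕ.* centralBinomial (suc m) ≡ (4 ℕ.* m ℕ.+ 2) ℕ.* centralBinomial m
centralBinomial-suc m = ℕₚ.*-cancelʳ-≡ _ _ k {{ℕₚ.m*n≢0 (suc m) (m ! ℕ.* m !) {{_}} {{m ℕₚ.!* m !≢0}}}} (begin
  suc m ℕ.* B' ℕ.* k
    ≡⟨ solve 3 (λ m b f → (con 1 :+ m) :* b :* ((con 1 :+ m) :* (f :* f))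
        := b :* (((con 1 :+ m) :* f) :* ((con 1 :+ m) :* f))) ≡.refl m B' (m !) ⟩
  B' ℕ.* (suc m ! ℕ.* suc m !)                   ≡⟨ centralBinomial-factorials (suc m) ⟩
  (suc m ℕ.+ suc m) !                            ≡⟨ ≡.cong (λ x → suc x !) (ℕₚ.+-suc m m) ⟩
  (2 ℕ.+ (m ℕ.+ m)) ℕ.* ((1 ℕ.+ (m ℕ.+ m)) ℕ.* (m ℕ.+ m) !)
    ≡⟨ ≡.cong (λ x → (2 ℕ.+ (m ℕ.+ m)) ℕ.* ((1 ℕ.+ (m ℕ.+ m)) ℕ.* x)) (centralBinomial-factorials m) ⟨
  (2 ℕ.+ (m ℕ.+ m)) ℕ.* ((1 ℕ.+ (m ℕ.+ m)) ℕ.* (B ℕ.* (m ! ℕ.* m !)))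
    ≡⟨ solve 3 (λ m b f → (con 2 :+ (m :+ m)) :* ((con 1 :+ (m :+ m)) :* (b :* f))
        := (con 4 :* m :+ con 2) :* b :* ((con 1 :+ m) :* f)) ≡.refl m B (m ! ℕ.* m !) ⟩
  (4 ℕ.* m ℕ.+ 2) ℕ.* B ℕ.* k ∎)
  where
  open ≡.≡-Reasoning
  open +-*-Solver
  B = centralBinomial m
  B' = centralBinomial (suc m)
  k = suc m ℕ.* (m ! ℕ.* m !)

-- Pascal's rule gives two neighbouring entries in the middle of an odd row, equal by symmetry. The
-- resulting 2 cancels the 2 in β = δ + 2Λ.
centralBinomial-half : ∀ k → centralBinomial (suc k) ≡ ((2 ℕ.* suc k ℕ.∸ 1) C k) ℕ.+ ((2 ℕ.* suc k ℕ.∸ 1) C k)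
centralBinomial-half k rewrite ℕₚ.+-identityʳ k = ≡.trans (≡.sym (nCk+nC[k+1]≡[n+1]C[k+1] (k ℕ.+ suc k) k))
  (≡.cong ((k ℕ.+ suc k) C k ℕ.+_) (≡.trans (nCk≡nC[n∸k] (ℕₚ.m≤n+m (suc k) k))
    (≡.cong ((k ℕ.+ suc k) C_) (ℕₚ.m+n∸n≡m k (suc k)))))

-- Transfer matrices, the Catalan equation and its differential equation

module TransferIdentities (K : CommutativeRing 0ℓ 0ℓ) where
  open CommutativeRing K
  open DifferenceSolver K
  open import Algebra.Properties.Ring ring using (x+x≈x⇒x≈0)
  open import Relation.Binary.Reasoning.Setoid setoid

  -- The column `(1 , c)` is `c` times the matrix with rows `(1 , - z)` and `(1 , 0)` applied to
  -- `(1 , c')`. The row `(A , B)` is multiplied by this matrix from the right, while `P` collects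
  -- the factor `c`.
  transfer-step : ∀ {P A B c c' z v} → c ≈ 1# + (z * c') * c → P * (A + B * c) ≈ v →
    (P * c) * ((A + B) + (- (z * A)) * c') ≈ v
  transfer-step {P} {A} {B} {c} {c'} {z} {v} e h = begin
    (P * c) * ((A + B) + (- (z * A)) * c')
      ≈⟨ solve 6 (λ P A B c c' z → (P :* c) :* ((A :+ B) :+ (:- (z :* A)) :* c')
           := P :* (A :* c :+ B :* c :- A :* ((z :* c') :* c))) refl P A B c c' z ⟩
    P * (A * c + B * c - A * ((z * c') * c))
      ≈⟨ *-congˡ (+-congʳ (+-congʳ (*-congˡ e))) ⟩
    P * (A * (1# + (z * c') * c) + B * c - A * ((z * c') * c))
      ≈⟨ solve 5 (λ P A B c u → P :* (A :* (:1 :+ u) :+ B :* c :- A :* u) := P :* (A :+ B :* c)) refl P A B c ((z * c') * c) ⟩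
    P * (A + B * c)   ≈⟨ h ⟩
    v ∎

  determinant-step : ∀ z A B A' B' → (A + B) * (- (z * A')) - (A' + B') * (- (z * A)) ≈ z * (A * B' - A' * B)
  determinant-step = solve 5 (λ z A B A' B' → (A :+ B) :* (:- (z :* A')) :- (A' :+ B') :* (:- (z :* A)) := z :* (A :* B' :- A' :* B)) refl

  -- Cayley–Hamilton for the transfer matrix with eigenvector (c , 1) and eigenvalue 1/P.
  characteristic : ∀ {P A B A' B' c W} → P * (A + B * c) ≈ 1# → P * (A' + B' * c) ≈ c →
    A * B' - A' * B ≈ W → (A + B') * P ≈ 1# + W * (P * P)
  characteristic {P} {A} {B} {A'} {B'} {c} {W} h h' hW = begin
    (A + B') * P
      ≈⟨ solve 3 (λ A B' P → (A :+ B') :* P := (A :* P) :+ (:1 :* (B' :* P))) refl A B' P ⟩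
    A * P + 1# * (B' * P)
      ≈⟨ +-congˡ (*-congʳ h) ⟨
    A * P + P * (A + B * c) * (B' * P)
      ≈⟨ solve 6 (λ P A B A' B' c → A :* P :+ P :* (A :+ B :* c) :* (B' :* P)
          := A :* P :+ (A :* B' :- A' :* B) :* (P :* P) :+ P :* B :* (P :* (A' :+ B' :* c))) refl P A B A' B' c ⟩
    A * P + (A * B' - A' * B) * (P * P) + P * B * (P * (A' + B' * c))
      ≈⟨ +-cong (+-congˡ (*-congʳ hW)) (*-congˡ h') ⟩
    A * P + W * (P * P) + P * B * c
      ≈⟨ solve 5 (λ P A B c W → A :* P :+ W :* (P :* P) :+ P :* B :* c := P :* (A :+ B :* c) :+ W :* (P :* P)) refl P A B c W ⟩
    P * (A + B * c) + W * (P * P)   ≈⟨ +-congʳ h ⟩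
    1# + W * (P * P) ∎

  module Derivation (∂ : Carrier → Carrier) (∂-cong : ∀ {x y} → x ≈ y → ∂ x ≈ ∂ y)
    (∂-+ : ∀ x y → ∂ (x + y) ≈ ∂ x + ∂ y) (∂-* : ∀ x y → ∂ (x * y) ≈ ∂ x * y + x * ∂ y) where

    ∂-1 : ∂ 1# ≈ 0#
    ∂-1 = x+x≈x⇒x≈0 _ (begin
      ∂ 1# + ∂ 1#           ≈⟨ +-cong (*-identityʳ _) (*-identityˡ _) ⟨
      ∂ 1# * 1# + 1# * ∂ 1# ≈⟨ ∂-* 1# 1# ⟨
      ∂ (1# * 1#)           ≈⟨ ∂-cong (*-identityˡ 1#) ⟩
      ∂ 1#                  ∎)

    -- With y = W P, the series β = δ + 2Λ is δ/(1 - 2y) = δ/√(1 - 4W).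
    inverse-square-root-ODE : ∀ {P l W Λ δ} → P * l ≈ 1# → P ≈ 1# + W * (P * P) →
      ∂ P ≈ Λ * P → ∂ W ≈ δ * W → ∂ δ ≈ 0# → let β = δ + (Λ + Λ) in
      ∂ β ≈ W * ((∂ β + ∂ β + (∂ β + ∂ β)) + (δ * β + δ * β))
    inverse-square-root-ODE {P} {l} {W} {Λ} {δ} Pl eP ∂P ∂W ∂δ = begin
      ∂ β
        ≈⟨ solve 3 (λ b W d → b := (b :+ d) :- d) refl (∂ β) W (∂ y * δ + ∂ y * δ) ⟩
      ∂ β + (∂ y * δ + ∂ y * δ) - (∂ y * δ + ∂ y * δ)
        ≈⟨ +-cong differentiated (-‿cong (+-cong ∂yδ ∂yδ)) ⟩
      W * (∂ β + ∂ β + (∂ β + ∂ β)) + δ * W * (β + β + (β + β)) - (W * (δ * β) + W * (δ * β))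
        ≈⟨ solve 4 (λ W b δ β → W :* (b :+ b :+ (b :+ b)) :+ δ :* W :* (β :+ β :+ (β :+ β)) :- (W :* (δ :* β) :+ W :* (δ :* β))
             := W :* ((b :+ b :+ (b :+ b)) :+ (δ :* β :+ δ :* β))) refl W (∂ β) δ β ⟩
      W * ((∂ β + ∂ β + (∂ β + ∂ β)) + (δ * β + δ * β)) ∎
      where
      y β : Carrier
      y = W * P
      β = δ + (Λ + Λ)

      y-quadratic : y ≈ W + y * y
      y-quadratic = begin
        W * P                       ≈⟨ *-congˡ eP ⟩
        W * (1# + W * (P * P))      ≈⟨ solve 2 (λ W P → W :* (:1 :+ W :* (P :* P)) := W :+ (W :* P) :* (W :* P)) refl W P ⟩
        W + y * y                   ∎

      ∂y : ∂ y ≈ δ * W + (y + y) * ∂ y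
      ∂y = begin
        ∂ y                             ≈⟨ ∂-cong y-quadratic ⟩
        ∂ (W + y * y)                   ≈⟨ trans (∂-+ _ _) (+-cong ∂W (∂-* y y)) ⟩
        δ * W + (∂ y * y + y * ∂ y)     ≈⟨ solve 3 (λ u y d → u :+ (d :* y :+ y :* d) := u :+ (y :+ y) :* d) refl (δ * W) y (∂ y) ⟩
        δ * W + (y + y) * ∂ y           ∎

      -- The logarithmic derivative of P = 1 + WP², with multiplication by `l` in place of division
      -- by `P`.
      Λ-equation : Λ ≈ δ * y + (y + y) * Λ
      Λ-equation = begin
        Λ                     ≈⟨ *-identityʳ Λ ⟨
        Λ * 1#                ≈⟨ *-congˡ Pl ⟨
        Λ * (P * l)           ≈⟨ *-assoc Λ P l ⟨
        Λ * P * l             ≈⟨ *-congʳ ∂P ⟨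
        ∂ P * l               ≈⟨ *-congʳ (trans (∂-cong eP) (∂-+ 1# _)) ⟩
        (∂ 1# + ∂ (W * (P * P))) * l
          ≈⟨ *-congʳ (+-cong ∂-1 (trans (∂-* W (P * P)) (+-cong (*-congʳ ∂W)
               (*-congˡ (trans (∂-* P P) (+-cong (*-congʳ ∂P) (*-congˡ ∂P))))))) ⟩
        (0# + ((δ * W) * (P * P) + W * (Λ * P * P + P * (Λ * P)))) * l
          ≈⟨ solve 5 (λ δ W P Λ l → (:0 :+ ((δ :* W) :* (P :* P) :+ W :* (Λ :* P :* P :+ P :* (Λ :* P)))) :* l
               := (δ :* (W :* P) :+ (W :* P :+ W :* P) :* Λ) :* (P :* l)) refl δ W P Λ l ⟩
        (δ * y + (y + y) * Λ) * (P * l)   ≈⟨ *-congˡ Pl ⟩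
        (δ * y + (y + y) * Λ) * 1#        ≈⟨ *-identityʳ _ ⟩
        δ * y + (y + y) * Λ               ∎

      β-equation : (1# - (y + y)) * β ≈ δ
      β-equation = begin
        (1# - (y + y)) * (δ + (Λ + Λ))
          ≈⟨ solve 3 (λ y δ Λ → (:1 :- (y :+ y)) :* (δ :+ (Λ :+ Λ))
               := δ :- (y :+ y) :* δ :+ ((Λ :+ Λ) :- (y :+ y) :* (Λ :+ Λ))) refl y δ Λ ⟩
        δ - (y + y) * δ + ((Λ + Λ) - (y + y) * (Λ + Λ))
          ≈⟨ +-congˡ (+-congʳ (+-cong Λ-equation Λ-equation)) ⟩
        δ - (y + y) * δ + ((δ * y + (y + y) * Λ + (δ * y + (y + y) * Λ)) - (y + y) * (Λ + Λ))
          ≈⟨ solve 3 (λ y δ Λ → δ :- (y :+ y) :* δ :+ ((δ :* y :+ (y :+ y) :* Λ :+ (δ :* y :+ (y :+ y) :* Λ)) :- (y :+ y) :* (Λ :+ Λ))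
               := δ) refl y δ Λ ⟩
        δ ∎

      -- Trading `δ` for (1 - 2y)β lets the factor 1 - 2y act on `∂ y`, where `∂y` evaluates it to
      -- `δ * W`; 1 - 2y is never inverted.
      ∂yδ : ∂ y * δ ≈ W * (δ * β)
      ∂yδ = begin
        ∂ y * δ                        ≈⟨ *-congˡ β-equation ⟨
        ∂ y * ((1# - (y + y)) * β)     ≈⟨ solve 3 (λ d y β → d :* ((:1 :- (y :+ y)) :* β) := (d :- (y :+ y) :* d) :* β) refl (∂ y) y β ⟩
        (∂ y - (y + y) * ∂ y) * β      ≈⟨ *-congʳ (+-congʳ ∂y) ⟩
        (δ * W + (y + y) * ∂ y - (y + y) * ∂ y) * β
          ≈⟨ solve 4 (λ δ W u β → (δ :* W :+ u :- u) :* β := W :* (δ :* β)) refl δ W ((y + y) * ∂ y) β ⟩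
        W * (δ * β) ∎

      -- (1 - 4W)β = (1 - 2y)²β = (1 - 2y)δ, with the negative terms moved across.
      undifferentiated : β + (y * δ + y * δ) ≈ δ + W * (β + β + (β + β))
      undifferentiated = begin
        β + (y * δ + y * δ)
          ≈⟨ +-congˡ (+-cong (*-congˡ β-equation) (*-congˡ β-equation)) ⟨
        β + (y * ((1# - (y + y)) * β) + y * ((1# - (y + y)) * β))
          ≈⟨ solve 2 (λ y β → β :+ (y :* ((:1 :- (y :+ y)) :* β) :+ y :* ((:1 :- (y :+ y)) :* β))
               := (:1 :- (y :+ y)) :* β :+ (y :- y :* y) :* (β :+ β :+ (β :+ β))) refl y β ⟩
        (1# - (y + y)) * β + (y - y * y) * (β + β + (β + β))
          ≈⟨ +-cong β-equation (*-congʳ (trans (+-congʳ y-quadratic) (solve 2 (λ W u → (W :+ u) :- u := W) refl W (y * y)))) ⟩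
        δ + W * (β + β + (β + β)) ∎

      differentiated : ∂ β + (∂ y * δ + ∂ y * δ) ≈ W * (∂ β + ∂ β + (∂ β + ∂ β)) + δ * W * (β + β + (β + β))
      differentiated = begin
        ∂ β + (∂ y * δ + ∂ y * δ)
          ≈⟨ +-congˡ (+-cong ∂yδ' ∂yδ') ⟨
        ∂ β + (∂ (y * δ) + ∂ (y * δ))
          ≈⟨ trans (∂-+ β _) (+-congˡ (∂-+ _ _)) ⟨
        ∂ (β + (y * δ + y * δ))                    ≈⟨ ∂-cong undifferentiated ⟩
        ∂ (δ + W * (β + β + (β + β)))              ≈⟨ trans (∂-+ _ _) (+-cong ∂δ (trans (∂-* W _)
          (+-cong (*-congʳ ∂W) (*-congˡ (trans (∂-+ _ _) (+-cong (∂-+ β β) (∂-+ β β))))))) ⟩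
        0# + (δ * W * (β + β + (β + β)) + W * (∂ β + ∂ β + (∂ β + ∂ β)))
          ≈⟨ solve 2 (λ u v → :0 :+ (u :+ v) := v :+ u) refl _ _ ⟩
        W * (∂ β + ∂ β + (∂ β + ∂ β)) + δ * W * (β + β + (β + β)) ∎
        where
        ∂yδ' : ∂ (y * δ) ≈ ∂ y * δ
        ∂yδ' = trans (∂-* y δ) (trans (+-congˡ (trans (*-congˡ ∂δ) (zeroʳ _))) (+-identityʳ _))

module TransferMatrix (R : CommutativeRing 0ℓ 0ℓ) (p q : CommutativeRing.Carrier R)
  (pq≈1 : CommutativeRing._≈_ R (CommutativeRing._*_ R p q) (CommutativeRing.1# R)) where
  open CommutativeRing R
  open DifferenceSolver R
  open PowersAndMultiples R
  open PowerSeries R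
  open CarlitzSeries R p q pq≈1
  open TransferIdentities seriesRing
  private
    module Sum𝕊 = FiniteSums seriesRing
    module S = DifferenceSolver seriesRing
    module ≈-Reasoning = Setoid-Reasoning setoid
    module ≋-Reasoning = Setoid-Reasoning 𝕊.setoid

  -- zₖ = pᵏz, C⟨ k ⟩ = C(pᵏz) and Π k = C(z)C(pz)⋯C(pᵏ⁻¹z).
  zₖ C⟨_⟩ Π : ℕ → Ser
  zₖ k    = const (pow p k) ⊛ Z
  C⟨ k ⟩  = σ (pow p k) 𝐂
  Π zero    = const 1#
  Π (suc k) = Π k ⊛ C⟨ k ⟩

  zₖ-⊛ : ∀ k a → zₖ k ⊛ a ≋ pow p k • shift a
  zₖ-⊛ k a = begin
    const (pow p k) ⊛ Z ⊛ a     ≈⟨ 𝕊.*-assoc (const (pow p k)) Z a ⟩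
    const (pow p k) ⊛ (Z ⊛ a)   ≈⟨ 𝕊.*-congˡ (Z-⊛ a) ⟩
    const (pow p k) ⊛ shift a   ≈⟨ const-⊛ (pow p k) (shift a) ⟩
    pow p k • shift a           ∎
    where open ≋-Reasoning

  C⟨0⟩ : C⟨ 0 ⟩ ≋ 𝐂
  C⟨0⟩ = σ-1 𝐂 refl

  σp-C⟨⟩ : ∀ k → σ p C⟨ k ⟩ ≋ C⟨ suc k ⟩
  σp-C⟨⟩ k = σ-σ p (pow p k) 𝐂

  C⟨⟩-fixpoint : ∀ k → C⟨ k ⟩ ≋ const 1# ⊕ (zₖ k ⊛ C⟨ suc k ⟩) ⊛ C⟨ k ⟩
  C⟨⟩-fixpoint k = begin
    σ pᵏ 𝐂                                          ≈⟨ σ-cong pᵏ C-fixpoint ⟩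
    σ pᵏ (const 1# ⊕ shift (σ p 𝐂) ⊛ 𝐂)             ≈⟨ σ-⊕ pᵏ _ _ ⟩
    σ pᵏ (const 1#) ⊕ σ pᵏ (shift (σ p 𝐂) ⊛ 𝐂)      ≈⟨ 𝕊.+-cong (σ-const pᵏ 1#) (σ-⊛ pᵏ (shift (σ p 𝐂)) 𝐂) ⟩
    const 1# ⊕ σ pᵏ (shift (σ p 𝐂)) ⊛ C⟨ k ⟩        ≈⟨ 𝕊.+-congˡ (𝕊.*-congʳ (begin
      σ pᵏ (shift (σ p 𝐂))     ≈⟨ σ-shift pᵏ (σ p 𝐂) ⟩
      pᵏ • shift (σ pᵏ (σ p 𝐂)) ≈⟨ zₖ-⊛ k _ ⟨
      zₖ k ⊛ σ pᵏ (σ p 𝐂)      ≈⟨ 𝕊.*-congˡ (𝕊.trans (σ-comm pᵏ p 𝐂) (σp-C⟨⟩ k)) ⟩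
      zₖ k ⊛ C⟨ suc k ⟩        ∎)) ⟩
    const 1# ⊕ (zₖ k ⊛ C⟨ suc k ⟩) ⊛ C⟨ k ⟩ ∎
    where
    open ≋-Reasoning
    pᵏ = pow p k

  -- The row `(a , b)` times the product of the first `k` transfer matrices. The two unit vectors
  -- give the two rows of that product.
  module Row (a b : Ser) where
    A B : ℕ → Ser
    A zero    = a
    A (suc k) = A k ⊕ B k
    B zero    = b
    B (suc k) = ⊖ (zₖ k ⊛ A k)

    invariant : ∀ k → Π k ⊛ (A k ⊕ B k ⊛ C⟨ k ⟩) ≋ a ⊕ b ⊛ 𝐂
    invariant zero    = 𝕊.trans (𝕊.*-identityˡ _) (𝕊.+-congˡ (𝕊.*-congˡ C⟨0⟩))
    invariant (suc k) = transfer-step (C⟨⟩-fixpoint k) (invariant k)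

    module _ (e : ℕ) (e≤1 : e ℕ.≤ 1)
      (A₁ : ∀ i → 1 ℕ.≤ i → A 1 i ≈ 0#) (B₁ : ∀ i → 1 ℕ.+ e ℕ.≤ i → B 1 i ≈ 0#) where

      -- The induction starts after one matrix, where `A` is the constant 1 in both rows while `B`
      -- is -z in the first row and 0 in the second. Hence `e` is 1 for the first row and 0 for the
      -- second; the trace takes `B` only from the second row, so its degree stays below the number
      -- of matrices.
      degrees : ∀ k → (∀ i → suc k ℕ.≤ i → A (suc k) i ≈ 0#) × (∀ i → suc k ℕ.+ e ℕ.≤ i → B (suc k) i ≈ 0#)
      degrees zero    = A₁ , B₁
      degrees (suc k) with degrees k
      ... | Aₖ , Bₖ = Aₖ₊₁ , Bₖ₊₁
        where
        Aₖ₊₁ : ∀ i → suc (suc k) ℕ.≤ i → A (suc (suc k)) i ≈ 0#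
        Aₖ₊₁ i k<i = trans (+-cong (Aₖ i (ℕₚ.<⇒≤ k<i))
          (Bₖ i (ℕₚ.≤-trans (ℕₚ.+-monoʳ-≤ (suc k) e≤1) (ℕₚ.≤-trans (ℕₚ.≤-reflexive (ℕₚ.+-comm (suc k) 1)) k<i))))
          (+-identityʳ _)

        Bₖ₊₁ : ∀ i → suc (suc k) ℕ.+ e ℕ.≤ i → B (suc (suc k)) i ≈ 0#
        Bₖ₊₁ (suc i) (s≤s k≤i) = trans (-‿cong (trans (zₖ-⊛ (suc k) (A (suc k)) .at (suc i))
          (*-congˡ (Aₖ i (ℕₚ.≤-trans (ℕₚ.m≤m+n (suc k) e) k≤i)))))
          (solve 1 (λ x → :- (x :* :0) := :0) refl _)

  private
    module Row₁ = Row (const 1#) 𝕊.0#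
    module Row₂ = Row 𝕊.0# (const 1#)

  W τ : ℕ → Ser
  W zero    = const 1#
  W (suc k) = zₖ k ⊛ W k
  τ k = Row₁.A k ⊕ Row₂.B k

  private
    determinant : ∀ k → Row₁.A k ⊛ Row₂.B k ⊕ ⊖ (Row₂.A k ⊛ Row₁.B k) ≋ W k
    determinant zero    = S.solve 0 (S.:1 S.:* S.:1 S.:- S.:0 S.:* S.:0 S.:= S.:1) 𝕊.refl
    determinant (suc k) = 𝕊.trans (determinant-step (zₖ k) (Row₁.A k) (Row₁.B k) (Row₂.A k) (Row₂.B k)) (𝕊.*-congˡ (determinant k))

    row₁ : ∀ k → Π k ⊛ (Row₁.A k ⊕ Row₁.B k ⊛ C⟨ k ⟩) ≋ const 1#
    row₁ k = 𝕊.trans (Row₁.invariant k) (𝕊.trans (𝕊.+-congˡ (𝕊.zeroˡ 𝐂)) (𝕊.+-identityʳ _))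

    row₂ : ∀ k → Π k ⊛ (Row₂.A k ⊕ Row₂.B k ⊛ C⟨ k ⟩) ≋ 𝐂
    row₂ k = 𝕊.trans (Row₂.invariant k) (𝕊.trans (𝕊.+-identityˡ _) (𝕊.*-identityˡ 𝐂))

  τ-degree : ∀ k i → suc k ℕ.≤ i → τ (suc k) i ≈ 0#
  τ-degree k i k<i = trans (+-cong
      (proj₁ (Row₁.degrees 1 ℕₚ.≤-refl (λ { (suc i) _ → +-identityʳ _ }) B₁ k) i k<i)
      (proj₂ (Row₂.degrees 0 z≤n (λ { (suc i) _ → +-identityʳ _ }) B₁' k) i
        (≡.subst (ℕ._≤ i) (≡.sym (ℕₚ.+-identityʳ (suc k))) k<i)))
    (+-identityʳ _)
    where
    B₁ : ∀ i → 2 ℕ.≤ i → Row₁.B 1 i ≈ 0#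
    B₁ (suc zero) (s≤s ())
    B₁ (suc (suc i)) _ = trans (-‿cong (zₖ-⊛ 0 (const 1#) .at (suc (suc i)))) (solve 0 (:- (:1 :* :0) := :0) refl)

    B₁' : ∀ i → 1 ℕ.≤ i → Row₂.B 1 i ≈ 0#
    B₁' (suc i) _ = trans (-‿cong (zₖ-⊛ 0 𝕊.0# .at (suc i))) (solve 0 (:- (:1 :* :0) := :0) refl)

  Π₀ : ∀ k → Π k 0 ≈ 1#
  Π₀ zero    = refl
  Π₀ (suc k) = trans (*-cong (Π₀ k) (trans (*-identityˡ _) C₀)) (*-identityˡ _)

  -- Both sides are C(z)C(pz)⋯C(pᵏz). When p^d = 1 the last factor for k = d is C(z) again, and
  -- cancelling it shows that `Π d` is invariant under z ↦ pz.
  σp-Π : ∀ k → σ p (Π k) ⊛ 𝐂 ≋ Π k ⊛ C⟨ k ⟩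
  σp-Π zero    = 𝕊.*-cong (σ-const p 1#) (𝕊.sym C⟨0⟩)
  σp-Π (suc k) = begin
    σ p (Π k ⊛ C⟨ k ⟩) ⊛ 𝐂            ≈⟨ 𝕊.*-congʳ (𝕊.trans (σ-⊛ p (Π k) C⟨ k ⟩) (𝕊.*-congˡ (σp-C⟨⟩ k))) ⟩
    σ p (Π k) ⊛ C⟨ suc k ⟩ ⊛ 𝐂        ≈⟨ S.solve 3 (λ x y z → x S.:* y S.:* z S.:= x S.:* z S.:* y) 𝕊.refl (σ p (Π k)) C⟨ suc k ⟩ 𝐂 ⟩
    σ p (Π k) ⊛ 𝐂 ⊛ C⟨ suc k ⟩        ≈⟨ 𝕊.*-congʳ (σp-Π k) ⟩
    Π k ⊛ C⟨ k ⟩ ⊛ C⟨ suc k ⟩         ∎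
    where
    open ≋-Reasoning

  shiftBy : ℕ → Ser → Ser
  shiftBy zero    a = a
  shiftBy (suc k) a = shift (shiftBy k a)

  shiftBy-at : ∀ k a n → shiftBy k a (k ℕ.+ n) ≈ a n
  shiftBy-at zero    a n = refl
  shiftBy-at (suc k) a n = shiftBy-at k a n

  W-⊛ : ∀ k a → W k ⊛ a ≋ pow p (T k) • shiftBy k a
  W-⊛ zero    a = const-⊛ 1# a
  W-⊛ (suc k) a = begin
    zₖ k ⊛ W k ⊛ a                             ≈⟨ 𝕊.*-assoc (zₖ k) (W k) a ⟩
    zₖ k ⊛ (W k ⊛ a)                           ≈⟨ 𝕊.*-congˡ (W-⊛ k a) ⟩
    zₖ k ⊛ (pow p (T k) • shiftBy k a)         ≈⟨ zₖ-⊛ k _ ⟩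
    pow p k • shift (pow p (T k) • shiftBy k a)
      ≈⟨ pointwise (λ { zero → trans (zeroʳ _) (sym (zeroʳ _))
                      ; (suc n) → trans (sym (*-assoc _ _ _)) (*-congʳ (sym (pow-+ p k (T k)))) }) ⟩
    pow p (T (suc k)) • shiftBy (suc k) a      ∎
    where open ≋-Reasoning

  W-at : ∀ k a n → (W k ⊛ a) (k ℕ.+ n) ≈ pow p (T k) * a n
  W-at k a n = trans (W-⊛ k a .at (k ℕ.+ n)) (*-congˡ (shiftBy-at k a n))

  private
    W-homogeneous : ∀ k → W k ≋ const (pow p (T k)) ⊛ shiftBy k (const 1#)
    W-homogeneous k = 𝕊.trans (𝕊.sym (𝕊.*-identityʳ (W k))) (𝕊.trans (W-⊛ k (const 1#)) (𝕊.sym (const-⊛ _ _)))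

    shiftBy-support : ∀ k n → n ≡ k ⊎ shiftBy k (const 1#) n ≈ 0#
    shiftBy-support zero    zero    = inj₁ ≡.refl
    shiftBy-support zero    (suc n) = inj₂ refl
    shiftBy-support (suc k) zero    = inj₂ refl
    shiftBy-support (suc k) (suc n) with shiftBy-support k n
    ... | inj₁ e = inj₁ (≡.cong suc e)
    ... | inj₂ e = inj₂ e

  W-support : ∀ k n → n ≡ k ⊎ W k n ≈ 0#
  W-support k n with shiftBy-support k n
  ... | inj₁ e = inj₁ e
  ... | inj₂ e = inj₂ (trans (W-homogeneous k .at n) (trans (const-⊛ _ _ .at n) (trans (*-congˡ e) (zeroʳ _))))

  D-W : ∀ k → D (W k) ≋ const (nat k) ⊛ W k
  D-W k = 𝕊.trans (pointwise at-n) (𝕊.sym (const-⊛ (nat k) (W k)))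
    where
    at-n : ∀ n → nat n * W k n ≈ nat k * W k n
    at-n n with W-support k n
    ... | inj₁ ≡.refl = refl
    ... | inj₂ e      = trans (*-congˡ e) (trans (zeroʳ _) (sym (trans (*-congˡ e) (zeroʳ _))))

  Λ : ℕ → Ser
  Λ k = Sum𝕊.sum k (λ i → σ (pow p i) L)

  D-Π : ∀ k → D (Π k) ≋ Λ k ⊛ Π k
  D-Π zero    = 𝕊.trans (D-const 1#) (𝕊.sym (𝕊.zeroˡ (const 1#)))
  D-Π (suc k) = begin
    D (Π k ⊛ C⟨ k ⟩)                                       ≈⟨ D-⊛ (Π k) C⟨ k ⟩ ⟩
    D (Π k) ⊛ C⟨ k ⟩ ⊕ Π k ⊛ D C⟨ k ⟩                      ≈⟨ 𝕊.+-cong (𝕊.*-congʳ (D-Π k)) (𝕊.*-congˡ (begin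
      D C⟨ k ⟩                        ≈⟨ σ-D (pow p k) 𝐂 ⟨
      σ (pow p k) (D 𝐂)               ≈⟨ σ-cong (pow p k) D-C ⟩
      σ (pow p k) (L ⊛ 𝐂)             ≈⟨ σ-⊛ (pow p k) L 𝐂 ⟩
      σ (pow p k) L ⊛ C⟨ k ⟩          ∎)) ⟩
    (Λ k ⊛ Π k) ⊛ C⟨ k ⟩ ⊕ Π k ⊛ (σ (pow p k) L ⊛ C⟨ k ⟩)
      ≈⟨ S.solve 4 (λ l P c l' → (l S.:* P) S.:* c S.:+ P S.:* (l' S.:* c) S.:= (l S.:+ l') S.:* (P S.:* c))
           𝕊.refl (Λ k) (Π k) C⟨ k ⟩ (σ (pow p k) L) ⟩
    (Λ k ⊕ σ (pow p k) L) ⊛ (Π k ⊛ C⟨ k ⟩) ∎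
    where
    open ≋-Reasoning

  -- Primitivity enters as cancellability of 1 - pⁿ for 0 < n < d, which is exactly what makes an
  -- invariant series of degree below d constant.
  module RootOfUnity (d' : ℕ) (pᵈ≈1 : pow p (suc d') ≈ 1#)
    (cancel-1-pⁿ : ∀ n x → 0 ℕ.< n → n ℕ.< suc d' → pow p n * x ≈ x → x ≈ 0#) where
    d : ℕ
    d = suc d'

    private
      P = Π d

      C⟨d⟩ : C⟨ d ⟩ ≋ 𝐂
      C⟨d⟩ = σ-1 𝐂 pᵈ≈1

      characteristic-Π : τ d ⊛ P ≋ const 1# ⊕ W d ⊛ (P ⊛ P)
      characteristic-Π = characteristic
        (𝕊.trans (𝕊.*-congˡ (𝕊.+-congˡ (𝕊.*-congˡ (𝕊.sym C⟨d⟩)))) (row₁ d))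
        (𝕊.trans (𝕊.*-congˡ (𝕊.+-congˡ (𝕊.*-congˡ (𝕊.sym C⟨d⟩)))) (row₂ d))
        (determinant d)

      cancel : ∀ {a b} f → f 0 ≈ 1# → a ⊛ f ≋ b ⊛ f → a ≋ b
      cancel {a} {b} f f₀ e = PowersAndMultiples.x-y≈0⇒x≈y seriesRing (⊛-cancelʳ-unit (a ⊕ ⊖ b) f f₀ (begin
        (a ⊕ ⊖ b) ⊛ f      ≈⟨ S.solve 3 (λ a b f → (a S.:- b) S.:* f S.:= a S.:* f S.:- b S.:* f) 𝕊.refl a b f ⟩
        a ⊛ f ⊕ ⊖ (b ⊛ f)  ≈⟨ 𝕊.+-congʳ e ⟩
        b ⊛ f ⊕ ⊖ (b ⊛ f)  ≈⟨ 𝕊.-‿inverseʳ (b ⊛ f) ⟩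
        𝕊.0#               ∎))
        where
        open ≋-Reasoning

      P-invariant : σ p P ≋ P
      P-invariant = cancel 𝐂 C₀ (𝕊.trans (σp-Π d) (𝕊.*-congˡ C⟨d⟩))

      W-invariant : σ p (W d) ≋ W d
      W-invariant .at n with W-support d n
      ... | inj₁ ≡.refl = trans (*-congʳ pᵈ≈1) (*-identityˡ _)
      ... | inj₂ e      = trans (*-congˡ e) (trans (zeroʳ _) (sym e))

      τ-invariant : σ p (τ d) ≋ τ d
      τ-invariant = cancel P (Π₀ d) (begin
        σ p (τ d) ⊛ P                            ≈⟨ 𝕊.*-congˡ P-invariant ⟨
        σ p (τ d) ⊛ σ p P                        ≈⟨ σ-⊛ p (τ d) P ⟨
        σ p (τ d ⊛ P)                            ≈⟨ σ-cong p characteristic-Π ⟩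
        σ p (const 1# ⊕ W d ⊛ (P ⊛ P))           ≈⟨ σ-⊕ p _ _ ⟩
        σ p (const 1#) ⊕ σ p (W d ⊛ (P ⊛ P))     ≈⟨ 𝕊.+-cong (σ-const p 1#) (𝕊.trans (σ-⊛ p (W d) _)
                                                      (𝕊.*-cong W-invariant (𝕊.trans (σ-⊛ p P P) (𝕊.*-cong P-invariant P-invariant)))) ⟩
        const 1# ⊕ W d ⊛ (P ⊛ P)                 ≈⟨ characteristic-Π ⟨
        τ d ⊛ P                                  ∎)
        where open ≋-Reasoning

      W₀ : W d 0 ≈ 0#
      W₀ with W-support d 0
      ... | inj₂ e = e

      -- The trace is invariant under z ↦ pz and has degree less than d.
      τ≋1 : τ d ≋ const 1#
      τ≋1 .at zero = begin
        τ d 0                          ≈⟨ *-identityʳ _ ⟨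
        τ d 0 * 1#                     ≈⟨ *-congˡ (Π₀ d) ⟨
        τ d 0 * P 0                    ≈⟨ characteristic-Π .at 0 ⟩
        1# + W d 0 * (P 0 * P 0)       ≈⟨ +-congˡ (trans (*-congʳ W₀) (zeroˡ _)) ⟩
        1# + 0#                        ≈⟨ +-identityʳ _ ⟩
        1#                             ∎
        where open ≈-Reasoning
      τ≋1 .at (suc n) with suc n ℕₚ.<? d
      ... | yes n<d = cancel-1-pⁿ (suc n) _ (s≤s z≤n) n<d (τ-invariant .at (suc n))
      ... | no  n≮d = τ-degree d' (suc n) (ℕₚ.≮⇒≥ n≮d)

      P-quadratic : P ≋ const 1# ⊕ W d ⊛ (P ⊛ P)
      P-quadratic = 𝕊.trans (𝕊.sym (𝕊.*-identityˡ P)) (𝕊.trans (𝕊.*-congʳ (𝕊.sym τ≋1)) characteristic-Π)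

    β : Ser
    β = const (nat d) ⊕ (Λ d ⊕ Λ d)

    private
      β-ODE : D β ≋ W d ⊛ ((D β ⊕ D β ⊕ (D β ⊕ D β)) ⊕ (const (nat d) ⊛ β ⊕ const (nat d) ⊛ β))
      β-ODE = Derivation.inverse-square-root-ODE D D-cong D-⊕ D-⊛
        (row₁ d) P-quadratic (D-Π d) (D-W d) (D-const (nat d))

    -- The differential equation read at index `d + n`: `W d` is a monomial of degree `d`, so
    -- multiplication by it moves coefficients by `d` places and scales them by the power `T d` of
    -- p.
    β-recursion : ∀ n → nat (d ℕ.+ n) * β (d ℕ.+ n) ≈ pow p (T d) * (nat (4 ℕ.* n ℕ.+ 2 ℕ.* d) * β n)
    β-recursion n = begin
      nat (d ℕ.+ n) * β (d ℕ.+ n)     ≈⟨ β-ODE .at (d ℕ.+ n) ⟩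
      _                               ≈⟨ W-at d _ n ⟩
      pow p (T d) * ((nat n * β n + nat n * β n + (nat n * β n + nat n * β n)) + ((const (nat d) ⊛ β) n + (const (nat d) ⊛ β) n))
        ≈⟨ *-congˡ (+-congˡ (+-cong (const-⊛ (nat d) β .at n) (const-⊛ (nat d) β .at n))) ⟩
      pow p (T d) * ((nat n * β n + nat n * β n + (nat n * β n + nat n * β n)) + (nat d * β n + nat d * β n))
        ≈⟨ *-congˡ (solve 3 (λ n d b → (n :* b :+ n :* b :+ (n :* b :+ n :* b)) :+ (d :* b :+ d :* b)
             := (con (4 , 0) :* n :+ con (2 , 0) :* d) :* b) refl (nat n) (nat d) (β n)) ⟩
      pow p (T d) * ((⟦ 4 , 0 ⟧ᵈ * nat n + ⟦ 2 , 0 ⟧ᵈ * nat d) * β n)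
        ≈⟨ *-congˡ (*-congʳ (+-cong (*-congʳ (solve 0 (con (4 , 0) := :1 :+ (:1 :+ (:1 :+ (:1 :+ :0)))) refl))
                                    (*-congʳ (solve 0 (con (2 , 0) := :1 :+ (:1 :+ :0)) refl)))) ⟩
      pow p (T d) * ((nat 4 * nat n + nat 2 * nat d) * β n)
        ≈⟨ *-congˡ (*-congʳ (trans (nat-+ (4 ℕ.* n) (2 ℕ.* d)) (+-cong (nat-* 4 n) (nat-* 2 d)))) ⟨
      pow p (T d) * (nat (4 ℕ.* n ℕ.+ 2 ℕ.* d) * β n) ∎
      where open ≈-Reasoning

    -- At an index divisible by `d` the substitutions z ↦ pⁱz act trivially, so all `d` summands of
    -- `Λ d` coincide.
    Λ-multiple : ∀ m → Λ d (m ℕ.* d) ≈ nat d * L (m ℕ.* d)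
    Λ-multiple m = trans (go d) (FiniteSums.sum-constant R d _)
      where
      pⁱ : ∀ i → pow (pow p i) d ≈ 1#
      pⁱ i = trans (sym (pow-* p d i)) (trans (reflexive (≡.cong (pow p) (ℕₚ.*-comm d i))) (pow-multiple pᵈ≈1 i))
      go : ∀ k → Λ k (m ℕ.* d) ≈ FiniteSums.sum R k (λ _ → L (m ℕ.* d))
      go zero    = refl
      go (suc k) = +-cong (go k) (trans (*-congʳ (pow-multiple (pⁱ k) m)) (*-identityˡ _))

-- The value of P_n at a primitive root of unity

module PrimitiveRootValue (R : CommutativeRing 0ℓ 0ℓ) (domain : IsCharZeroDomain R)
  (d' : ℕ) (ω : CommutativeRing.Carrier R) (isPrimitive : IsPrimitiveRoot R (suc d') ω) where
  open CommutativeRing R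
  open DifferenceSolver R
  open PowersAndMultiples R
  open PowerSeries R
  open Evaluation R ω
  open import Relation.Binary.Reasoning.Setoid setoid

  private
    p : Carrier
    -- With `d = suc d'`, this power is the inverse of `ω`, so no inverse has to be assumed in the
    -- ring.
    p = pow ω d'

    pω≈1 : p * ω ≈ 1#
    pω≈1 = trans (*-comm _ _) (proj₁ isPrimitive)

    pᵈ≈1 : pow p (suc d') ≈ 1#
    pᵈ≈1 = trans (sym (pow-* ω (suc d') d')) (trans (reflexive (≡.cong (pow ω) (ℕₚ.*-comm (suc d') d')))
      (pow-multiple (proj₁ isPrimitive) d'))

    cancel-1-pⁿ : ∀ n x → 0 ℕ.< n → n ℕ.< suc d' → pow p n * x ≈ x → x ≈ 0#
    cancel-1-pⁿ n x 0<n n<d e with proj₁ domain (pow p n - 1#) x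
      (trans (solve 2 (λ a x → (a :- :1) :* x := a :* x :- x) refl _ _) (trans (+-congʳ e) (-‿inverseʳ x)))
    ... | inj₂ x≈0 = x≈0
    ... | inj₁ h   = ⊥-elim (proj₂ isPrimitive n 0<n n<d (begin
      pow ω n               ≈⟨ *-identityˡ _ ⟨
      1# * pow ω n          ≈⟨ *-congʳ (x-y≈0⇒x≈y h) ⟨
      pow p n * pow ω n     ≈⟨ pow-inverse pω≈1 n ⟩
      1#                    ∎))

    cancel-nat : ∀ k {x y} → nat (suc k) * x ≈ nat (suc k) * y → x ≈ y
    cancel-nat k {x} {y} e with proj₁ domain (nat (suc k)) (x - y)
      (trans (solve 3 (λ a x y → a :* (x :- y) := a :* x :- a :* y) refl _ _ _) (trans (+-congʳ e) (-‿inverseʳ _)))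
    ... | inj₁ h = ⊥-elim (proj₂ domain k h)
    ... | inj₂ h = x-y≈0⇒x≈y h

  open CarlitzSeries R p ω pω≈1 using (L)
  open TransferMatrix R p ω pω≈1 using (Λ; module RootOfUnity)
  open RootOfUnity d' pᵈ≈1 cancel-1-pⁿ

  private
    ε : Carrier
    ε = pow p (T d)

    Λ-0 : Λ d 0 ≈ 0#
    Λ-0 = trans (Λ-multiple 0) (trans (*-congˡ (zeroʳ _)) (zeroʳ _))

    -- These are the coefficients of d/√(1 - 4W). The recursion determines them only after division
    -- by `suc m` and `d`, which is possible in a domain of characteristic zero.
    β-value : ∀ m → β (m ℕ.* d) ≈ nat d * (pow ε m * nat (centralBinomial m))
    β-value zero = begin
      nat d + (Λ d 0 + Λ d 0)       ≈⟨ +-congˡ (+-cong Λ-0 Λ-0) ⟩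
      nat d + (0# + 0#)             ≈⟨ solve 1 (λ x → x :+ (:0 :+ :0) := x :* (:1 :* (:1 :+ :0))) refl (nat d) ⟩
      nat d * (1# * (1# + 0#))      ∎
    β-value (suc m) = cancel-nat m (cancel-nat d' (begin
      nat d * (nat (suc m) * β (suc m ℕ.* d))
        ≈⟨ *-assoc _ _ _ ⟨
      nat d * nat (suc m) * β (d ℕ.+ m ℕ.* d)
        ≈⟨ *-congʳ (trans (*-comm _ _) (sym (nat-* (suc m) d))) ⟩
      nat (d ℕ.+ m ℕ.* d) * β (d ℕ.+ m ℕ.* d)
        ≈⟨ β-recursion (m ℕ.* d) ⟩
      ε * (nat (4 ℕ.* (m ℕ.* d) ℕ.+ 2 ℕ.* d) * β (m ℕ.* d))
        ≈⟨ *-congˡ (*-cong (trans (reflexive (≡.cong nat (factor m d))) (nat-* (4 ℕ.* m ℕ.+ 2) d)) (β-value m)) ⟩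
      ε * ((nat (4 ℕ.* m ℕ.+ 2) * nat d) * (nat d * (pow ε m * nat (centralBinomial m))))
        ≈⟨ solve 5 (λ e k d x b → e :* ((k :* d) :* (d :* (x :* b))) := d :* (d :* (e :* x)) :* (k :* b)) refl _ _ _ _ _ ⟩
      nat d * (nat d * (ε * pow ε m)) * (nat (4 ℕ.* m ℕ.+ 2) * nat (centralBinomial m))
        ≈⟨ *-congˡ (trans (sym (nat-* (4 ℕ.* m ℕ.+ 2) (centralBinomial m)))
             (trans (reflexive (≡.cong nat (≡.sym (centralBinomial-suc m)))) (nat-* (suc m) (centralBinomial (suc m))))) ⟩
      nat d * (nat d * (ε * pow ε m)) * (nat (suc m) * nat (centralBinomial (suc m)))
        ≈⟨ solve 4 (λ d x k b → d :* (d :* x) :* (k :* b) := d :* (k :* (d :* (x :* b)))) refl _ _ _ _ ⟩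
      nat d * (nat (suc m) * (nat d * (pow ε (suc m) * nat (centralBinomial (suc m))))) ∎))
      where
      factor : ∀ m d → 4 ℕ.* (m ℕ.* d) ℕ.+ 2 ℕ.* d ≡ (4 ℕ.* m ℕ.+ 2) ℕ.* d
      factor = N.solve 2 (λ m d → N.con 4 N.:* (m N.:* d) N.:+ N.con 2 N.:* d N.:= (N.con 4 N.:* m N.:+ N.con 2) N.:* d) ≡.refl
        where module N = +-*-Solver

    -- At a positive index the constant `nat d` in `β` contributes the `0#` below, so β = 2dL there;
    -- `cancel-nat d'` removes d and `cancel-nat 1` removes 2.
    L-value : ∀ k → L (suc k ℕ.* d) ≈ pow ε (suc k) * nat ((2 ℕ.* suc k ℕ.∸ 1) C k)
    L-value k = cancel-nat 1 (cancel-nat d' (begin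
      nat d * (nat 2 * L n)                     ≈⟨ solve 2 (λ d x → d :* ((:1 :+ (:1 :+ :0)) :* x) := :0 :+ (d :* x :+ d :* x)) refl _ _ ⟩
      0# + (nat d * L n + nat d * L n)          ≈⟨ +-congˡ (+-cong (Λ-multiple (suc k)) (Λ-multiple (suc k))) ⟨
      β n                                       ≈⟨ β-value (suc k) ⟩
      nat d * (pow ε (suc k) * nat (centralBinomial (suc k)))
        ≈⟨ *-congˡ (*-congˡ (trans (reflexive (≡.cong nat (centralBinomial-half k))) (nat-+ c c))) ⟩
      nat d * (pow ε (suc k) * (nat c + nat c))
        ≈⟨ solve 3 (λ d x c → d :* (x :* (c :+ c)) := d :* ((:1 :+ (:1 :+ :0)) :* (x :* c))) refl _ _ _ ⟩
      nat d * (nat 2 * (pow ε (suc k) * nat c)) ∎))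
      where
      n = suc k ℕ.* d
      c = (2 ℕ.* suc k ℕ.∸ 1) C k

    εᵐ-inverse : ∀ m → pow ω (T (m ℕ.* d)) * pow ε m ≈ 1#
    εᵐ-inverse m = begin
      pow ω (T (m ℕ.* d)) * pow ε m
        ≈⟨ *-congʳ (trans (reflexive (≡.cong (pow ω) (T-* d m))) (pow-+ ω (m ℕ.* T d) _)) ⟩
      pow ω (m ℕ.* T d) * pow ω ((d ℕ.* T m) ℕ.* d) * pow ε m
        ≈⟨ *-congʳ (trans (*-cong (pow-* ω m (T d)) (pow-multiple (proj₁ isPrimitive) (d ℕ.* T m))) (*-identityʳ _)) ⟩
      pow (pow ω (T d)) m * pow ε m
        ≈⟨ pow-inverse (trans (*-comm _ _) (pow-inverse pω≈1 (T d))) m ⟩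
      1# ∎

  logCarlitz-at-root : ∀ k → eval (logCarlitz (suc d' ℕ.* suc k)) ≈ nat ((2 ℕ.* suc k ℕ.∸ 1) C k)
  logCarlitz-at-root k = begin
    eval (logCarlitz (d ℕ.* suc k))                     ≈⟨ reflexive (≡.cong (λ x → eval (logCarlitz x)) (ℕₚ.*-comm d (suc k))) ⟩
    eval (logCarlitz n)                                 ≈⟨ *-identityˡ _ ⟨
    1# * eval (logCarlitz n)                            ≈⟨ *-congʳ (trans (*-comm _ _) (pow-inverse pω≈1 (T n))) ⟨
    pow ω (T n) * pow p (T n) * eval (logCarlitz n)     ≈⟨ *-assoc _ _ _ ⟩
    pow ω (T n) * L n                                   ≈⟨ *-congˡ (L-value k) ⟩
    pow ω (T n) * (pow ε (suc k) * nat c)               ≈⟨ *-assoc _ _ _ ⟨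
    pow ω (T n) * pow ε (suc k) * nat c                 ≈⟨ *-congʳ (εᵐ-inverse (suc k)) ⟩
    1# * nat c                                          ≈⟨ *-identityˡ _ ⟩
    nat c                                               ∎
    where
    n = suc k ℕ.* d
    c = (2 ℕ.* suc k ℕ.∸ 1) C k

-- Specialisation to rational values of q

ℚring : CommutativeRing 0ℓ 0ℓ
ℚring = ℚₚ.+-*-commutativeRing

module RationalPolynomials where
  open CommutativeRing ℚring using (_+_; _*_; -_; _-_; zeroˡ; zeroʳ; +-identityʳ; +-identityˡ; *-assoc; *-identityˡ; *-identityʳ)
  open DifferenceSolver ℚring
  open PowersAndMultiples ℚring
  open ≡.≡-Reasoning

  1-coprime : ∀ n → Coprime.Coprime n 1
  1-coprime n = Coprime.sym (Coprime.1-coprimeTo n)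

  natℚ≡mkℚ : ∀ n → natℚ n ≡ mkℚ (pos n) 0 (1-coprime n)
  natℚ≡mkℚ n = ℚₚ.normalize-coprime (1-coprime n)

  natℚ≡nat : ∀ n → natℚ n ≡ nat n
  natℚ≡nat zero    = ≡.refl
  natℚ≡nat (suc n) = begin
    natℚ (suc n)                                      ≡⟨ ≡.cong (λ i → (pos 1 ℤ.+ i) ℚ./ 1) (ℤₚ.*-identityʳ (pos n)) ⟨
    1ℚ + mkℚ (pos n) 0 (1-coprime n)                    ≡⟨ ≡.cong (1ℚ +_) (≡.trans (≡.sym (natℚ≡mkℚ n)) (natℚ≡nat n)) ⟩
    nat (suc n)                                       ∎

  nat-suc≢0 : ∀ n → nat (suc n) ≢ 0ℚ
  nat-suc≢0 n e with ≡.cong ℚ.ℚ.numerator (≡.trans (≡.sym (natℚ≡mkℚ (suc n))) (≡.trans (natℚ≡nat (suc n)) e))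
  ... | ()

  evalℚ : Poly → ℚ → ℚ
  evalℚ []      t = 0ℚ
  evalℚ (a ∷ r) t = a + t * evalℚ r t

  evalℚ-+ : ∀ r s t → evalℚ (r +ₚ s) t ≡ evalℚ r t + evalℚ s t
  evalℚ-+ []      s       t = ≡.sym (+-identityˡ _)
  evalℚ-+ (a ∷ r) []      t = ≡.sym (+-identityʳ _)
  evalℚ-+ (a ∷ r) (b ∷ s) t = ≡.trans (≡.cong (λ x → a + b + t * x) (evalℚ-+ r s t))
    (solve 5 (λ a b t x y → a :+ b :+ t :* (x :+ y) := a :+ t :* x :+ (b :+ t :* y)) ≡.refl a b t (evalℚ r t) (evalℚ s t))

  evalℚ-scale : ∀ c r t → evalℚ (scaleₚ c r) t ≡ c * evalℚ r t
  evalℚ-scale c []      t = ≡.sym (zeroʳ c)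
  evalℚ-scale c (a ∷ r) t = ≡.trans (≡.cong (λ x → c * a + t * x) (evalℚ-scale c r t))
    (solve 4 (λ c a t x → c :* a :+ t :* (c :* x) := c :* (a :+ t :* x)) ≡.refl c a t (evalℚ r t))

  evalℚ-* : ∀ r s t → evalℚ (r *ₚ s) t ≡ evalℚ r t * evalℚ s t
  evalℚ-* []      s t = ≡.sym (zeroˡ (evalℚ s t))
  evalℚ-* (a ∷ r) s t = begin
    evalℚ (scaleₚ a s +ₚ (0ℚ ∷ (r *ₚ s))) t              ≡⟨ evalℚ-+ (scaleₚ a s) (0ℚ ∷ (r *ₚ s)) t ⟩
    evalℚ (scaleₚ a s) t + (0ℚ + t * evalℚ (r *ₚ s) t)   ≡⟨ ≡.cong₂ (λ x y → x + (0ℚ + t * y)) (evalℚ-scale a s t) (evalℚ-* r s t) ⟩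
    a * evalℚ s t + (0ℚ + t * (evalℚ r t * evalℚ s t))
      ≡⟨ solve 4 (λ a s t x → a :* s :+ (:0 :+ t :* (x :* s)) := (a :+ t :* x) :* s) ≡.refl a (evalℚ s t) t (evalℚ r t) ⟩
    (a + t * evalℚ r t) * evalℚ s t                      ∎

  evalℚ-const : ∀ c t → evalℚ (constₚ c) t ≡ c
  evalℚ-const c t = ≡.trans (≡.cong (c +_) (zeroʳ t)) (+-identityʳ c)

  evalℚ-Xpow : ∀ k t → evalℚ (Xpow k) t ≡ pow t k
  evalℚ-Xpow zero    t = evalℚ-const 1ℚ t
  evalℚ-Xpow (suc k) t = ≡.trans (+-identityˡ _) (≡.cong (t *_) (evalℚ-Xpow k t))

  evalℚ-toℚPoly : ∀ (r : PolyN) t → evalℚ (toℚPoly (toPolyZ r)) t ≡ Evaluation.eval ℚring t r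
  evalℚ-toℚPoly []      t = ≡.refl
  evalℚ-toℚPoly (a ∷ r) t = ≡.cong₂ (λ x y → x + t * y) (natℚ≡nat a) (evalℚ-toℚPoly r t)

  cancel-nonzero : ∀ {x y} → x ≢ 0ℚ → x * y ≡ 0ℚ → y ≡ 0ℚ
  cancel-nonzero {x} {y} x≢0 e = begin
    y                        ≡⟨ *-identityˡ y ⟨
    1ℚ * y                   ≡⟨ ≡.cong (_* y) (ℚₚ.*-inverseˡ x) ⟨
    ℚ.1/ x * x * y           ≡⟨ *-assoc (ℚ.1/ x) x y ⟩
    ℚ.1/ x * (x * y)         ≡⟨ ≡.cong (ℚ.1/ x *_) e ⟩
    ℚ.1/ x * 0ℚ              ≡⟨ zeroʳ (ℚ.1/ x) ⟩
    0ℚ                       ∎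
    where instance _ = ℚ.≢-nonZero x≢0

  -- (a + X r(X) - (a + c r(c))) / (X - c), which does not depend on a.
  divided : Poly → ℚ → Poly
  divided []      c = []
  divided (b ∷ r) c = evalℚ (b ∷ r) c ∷ divided r c

  divided-correct : ∀ a r c t → evalℚ (a ∷ r) t ≡ evalℚ (a ∷ r) c + (t - c) * evalℚ (divided r c) t
  divided-correct a []      c t = solve 3 (λ a c t → a :+ t :* :0 := a :+ c :* :0 :+ (t :- c) :* :0) ≡.refl a c t
  divided-correct a (b ∷ r) c t = begin
    a + t * evalℚ (b ∷ r) t
      ≡⟨ ≡.cong (λ x → a + t * x) (divided-correct b r c t) ⟩
    a + t * (evalℚ (b ∷ r) c + (t - c) * evalℚ (divided r c) t)
      ≡⟨ solve 5 (λ a t c x y → a :+ t :* (x :+ (t :- c) :* y) := a :+ c :* x :+ (t :- c) :* (x :+ t :* y))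
           ≡.refl a t c (evalℚ (b ∷ r) c) (evalℚ (divided r c) t) ⟩
    a + c * evalℚ (b ∷ r) c + (t - c) * (evalℚ (b ∷ r) c + t * evalℚ (divided r c) t) ∎

  divided-length : ∀ r c → length (divided r c) ≡ length r
  divided-length []      c = ≡.refl
  divided-length (b ∷ r) c = ≡.cong suc (divided-length r c)

  Zero : Poly → Set
  Zero r = ∀ i → coeff r i ≡ 0ℚ

  -- The quotient lists the values at `c` of the successive tails of the polynomial. If these
  -- vanish, each coefficient equals the value of the tail that it starts.
  divided-zero : ∀ a r c → Zero (divided r c) → evalℚ (a ∷ r) c ≡ 0ℚ → Zero (a ∷ r)
  divided-zero a r c z e = λ { zero → head ; (suc i) → proj₂ (rest r z) i }
    where
    rest : ∀ r → Zero (divided r c) → evalℚ r c ≡ 0ℚ × Zero r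
    rest []      z = ≡.refl , λ _ → ≡.refl
    rest (b ∷ r) z = z 0 , divided-zero b r c (λ i → z (suc i)) (z 0)

    head : a ≡ 0ℚ
    head = begin
      a                    ≡⟨ ≡.trans (≡.cong (a +_) (zeroʳ c)) (+-identityʳ a) ⟨
      a + c * 0ℚ           ≡⟨ ≡.cong (λ x → a + c * x) (proj₁ (rest r z)) ⟨
      a + c * evalℚ r c    ≡⟨ e ⟩
      0ℚ                   ∎

  nat-injective-< : ∀ {m n} → m ℕ.< n → nat n - nat m ≢ 0ℚ
  nat-injective-< {m} {n} m<n e = nat-suc≢0 (n ℕ.∸ suc m) (begin
    nat (suc k)                  ≡⟨ solve 2 (λ x y → x := (x :+ y) :- y) ≡.refl (nat (suc k)) (nat m) ⟩
    nat (suc k) + nat m - nat m  ≡⟨ ≡.cong (_- nat m) (nat-+ (suc k) m) ⟨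
    nat (suc k ℕ.+ m) - nat m    ≡⟨ ≡.cong (λ x → nat x - nat m) (≡.trans (≡.sym (ℕₚ.+-suc k m)) (ℕₚ.m∸n+n≡m m<n)) ⟩
    nat n - nat m                ≡⟨ e ⟩
    0ℚ                           ∎)
    where k = n ℕ.∸ suc m

  -- A polynomial with infinitely many roots is zero. Dividing by X - m keeps every root beyond `m`
  -- and shortens the list by one; the length is a separate argument because the quotient is not a
  -- sublist, so recursion on it would not be structural.
  vanishing : ∀ l r → length r ≡ l → ∀ m → (∀ n → m ℕ.≤ n → evalℚ r (nat n) ≡ 0ℚ) → Zero r
  vanishing l       []      _      m h i = ≡.refl
  vanishing (suc l) (a ∷ r) ≡.refl m h = divided-zero a r (nat m)
    (vanishing l (divided r (nat m)) (divided-length r (nat m)) (suc m) (λ n m<n →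
      cancel-nonzero (nat-injective-< m<n) (begin
        (nat n - nat m) * evalℚ (divided r (nat m)) (nat n)       ≡⟨ +-identityˡ _ ⟨
        0ℚ + (nat n - nat m) * evalℚ (divided r (nat m)) (nat n)  ≡⟨ ≡.cong (λ x → x + _) (h m ℕₚ.≤-refl) ⟨
        evalℚ (a ∷ r) (nat m) + (nat n - nat m) * evalℚ (divided r (nat m)) (nat n)
          ≡⟨ divided-correct a r (nat m) (nat n) ⟨
        evalℚ (a ∷ r) (nat n)                                     ≡⟨ h n (ℕₚ.<⇒≤ m<n) ⟩
        0ℚ                                                        ∎)))
    (h m ℕₚ.≤-refl)

  coeff-+ : ∀ r s i → coeff (r +ₚ s) i ≡ coeff r i + coeff s i
  coeff-+ []      s       i       = ≡.sym (+-identityˡ _)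
  coeff-+ (a ∷ r) []      i       = ≡.sym (+-identityʳ _)
  coeff-+ (a ∷ r) (b ∷ s) zero    = ≡.refl
  coeff-+ (a ∷ r) (b ∷ s) (suc i) = coeff-+ r s i

  coeff-scale : ∀ c r i → coeff (scaleₚ c r) i ≡ c * coeff r i
  coeff-scale c []      i       = ≡.sym (zeroʳ c)
  coeff-scale c (a ∷ r) zero    = ≡.refl
  coeff-scale c (a ∷ r) (suc i) = coeff-scale c r i

  agreeing : ∀ r s m → (∀ n → m ℕ.≤ n → evalℚ r (nat n) ≡ evalℚ s (nat n)) → r ≈ₚ s
  agreeing r s m h i = x-y≈0⇒x≈y (begin
    coeff r i - coeff s i           ≡⟨ solve 2 (λ x y → x :- y := x :+ (:- :1) :* y) ≡.refl (coeff r i) (coeff s i) ⟩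
    coeff r i + (- 1ℚ) * coeff s i  ≡⟨ ≡.cong (coeff r i +_) (coeff-scale (- 1ℚ) s i) ⟨
    coeff r i + coeff s' i          ≡⟨ coeff-+ r s' i ⟨
    coeff (r +ₚ s') i               ≡⟨ vanishing _ (r +ₚ s') ≡.refl m difference-vanishes i ⟩
    0ℚ                              ∎)
    where
    s' = scaleₚ (- 1ℚ) s
    difference-vanishes : ∀ n → m ℕ.≤ n → evalℚ (r +ₚ s') (nat n) ≡ 0ℚ
    difference-vanishes n m≤n = begin
      evalℚ (r +ₚ s') t                 ≡⟨ evalℚ-+ r s' t ⟩
      evalℚ r t + evalℚ s' t            ≡⟨ ≡.cong₂ _+_ (h n m≤n) (evalℚ-scale (- 1ℚ) s t) ⟩
      evalℚ s t + (- 1ℚ) * evalℚ s t    ≡⟨ solve 1 (λ x → x :+ (:- :1) :* x := :0) ≡.refl (evalℚ s t) ⟩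
      0ℚ                                ∎
      where t = nat n

-- Values of fractions and of the series f and h at q = t

module Specialisation (t : ℚ) where
  open CommutativeRing ℚring using (_+_; _*_; -_; _-_; +-identityˡ; *-assoc; *-identityˡ; *-identityʳ; zeroˡ)
  open DifferenceSolver ℚring
  open PowersAndMultiples ℚring
  open FiniteSums ℚring
  open PowerSeries ℚring
  open RationalPolynomials
  open ≡.≡-Reasoning
  private module Pow𝕊 = PowersAndMultiples seriesRing

  infix 4 _≃ₜ_

  -- The fraction x takes the value v at q = t; its denominator is allowed to vanish there.
  record _≃ₜ_ (x : Frac) (v : ℚ) : Set where
    constructor value
    field cleared : evalℚ (num x) t ≡ v * evalℚ (den x) t
  open _≃ₜ_

  ≃ₜ-≡ : ∀ {x v w} → x ≃ₜ v → v ≡ w → x ≃ₜ w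
  ≃ₜ-≡ r ≡.refl = r

  ≃ₜ-zero : zeroF ≃ₜ 0ℚ
  ≃ₜ-zero .cleared = ≡.sym (zeroˡ (evalℚ (constₚ 1ℚ) t))

  ≃ₜ-[] : ∀ {x} → num x ≡ [] → x ≃ₜ 0ℚ
  ≃ₜ-[] {x} e = value (≡.trans (≡.cong (λ r → evalℚ r t) e) (≡.sym (zeroˡ (evalℚ (den x) t))))

  ≃ₜ-one : oneF ≃ₜ 1ℚ
  ≃ₜ-one .cleared = ≡.sym (*-identityˡ (evalℚ (constₚ 1ℚ) t))

  ≃ₜ-+ : ∀ {x y v w} → x ≃ₜ v → y ≃ₜ w → (x +F y) ≃ₜ (v + w)
  ≃ₜ-+ {x} {y} {v} {w} (value e) (value e') = value (begin
    evalℚ ((num x *ₚ den y) +ₚ (num y *ₚ den x)) t    ≡⟨ evalℚ-+ (num x *ₚ den y) (num y *ₚ den x) t ⟩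
    evalℚ (num x *ₚ den y) t + evalℚ (num y *ₚ den x) t
      ≡⟨ ≡.cong₂ _+_ (≡.trans (evalℚ-* (num x) (den y) t) (≡.cong (_* b) e)) (≡.trans (evalℚ-* (num y) (den x) t) (≡.cong (_* a) e')) ⟩
    v * a * b + w * b * a
      ≡⟨ solve 4 (λ v w a b → v :* a :* b :+ w :* b :* a := (v :+ w) :* (a :* b)) ≡.refl v w a b ⟩
    (v + w) * (a * b)                                 ≡⟨ ≡.cong ((v + w) *_) (evalℚ-* (den x) (den y) t) ⟨
    (v + w) * evalℚ (den x *ₚ den y) t                ∎)
    where
    a = evalℚ (den x) t
    b = evalℚ (den y) t

  ≃ₜ-* : ∀ {x y v w} → x ≃ₜ v → y ≃ₜ w → (x *F y) ≃ₜ (v * w)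
  ≃ₜ-* {x} {y} {v} {w} (value e) (value e') = value (begin
    evalℚ (num x *ₚ num y) t              ≡⟨ evalℚ-* (num x) (num y) t ⟩
    evalℚ (num x) t * evalℚ (num y) t     ≡⟨ ≡.cong₂ _*_ e e' ⟩
    v * a * (w * b)                       ≡⟨ solve 4 (λ v w a b → v :* a :* (w :* b) := v :* w :* (a :* b)) ≡.refl v w a b ⟩
    v * w * (a * b)                       ≡⟨ ≡.cong (v * w *_) (evalℚ-* (den x) (den y) t) ⟨
    v * w * evalℚ (den x *ₚ den y) t      ∎)
    where
    a = evalℚ (den x) t
    b = evalℚ (den y) t

  ≃ₜ-sum : ∀ n {s v} → (∀ j → s j ≃ₜ v j) → sumF n s ≃ₜ sum n v
  ≃ₜ-sum zero    h = ≃ₜ-zero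
  ≃ₜ-sum (suc n) h = ≃ₜ-+ (≃ₜ-sum n h) (h n)

  ≃ₜ-⊛ : ∀ {a b} {a' b' : Ser} → (∀ n → a n ≃ₜ a' n) → (∀ n → b n ≃ₜ b' n) → ∀ n → (a *S b) n ≃ₜ (a' ⊛ b') n
  ≃ₜ-⊛ {a' = a'} {b'} h h' n = ≃ₜ-≡
    (≃ₜ-sum (suc n) (λ i → ≃ₜ-* (h i) (h' (n ℕ.∸ i))))
    (≡.sym (antidiagonal≈sum (λ i j → a' i * b' j) n))

  ≃ₜ-^ : ∀ {a} {a' : Ser} → (∀ n → a n ≃ₜ a' n) → ∀ k n → (a ^S k) n ≃ₜ Pow𝕊.pow a' k n
  ≃ₜ-^ h zero    zero    = ≃ₜ-one
  ≃ₜ-^ h zero    (suc n) = ≃ₜ-zero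
  ≃ₜ-^ h (suc k) n       = ≃ₜ-⊛ h (≃ₜ-^ h k) n

  signℚ≡sign : ∀ n → signℚ n ≡ sign n
  signℚ≡sign zero    = ≡.refl
  signℚ≡sign (suc n) = ≡.cong -_ (signℚ≡sign n)

  -- The inverses of j + 1, of 1 - t^(n+1) and of t are given as witnesses, so that what follows
  -- consists of ring identities.
  module _ (r : ℕ → ℚ) (r-inverse : ∀ j → r j * nat (suc j) ≡ 1ℚ)
    (u : ℕ → ℚ) (u-inverse : ∀ n → u n * (1ℚ - pow t (suc n)) ≡ 1ℚ)
    (p : ℚ) (pt≡1 : p * t ≡ 1ℚ) where

    open FormalLogarithm ℚring r r-inverse
    open CarlitzSeries ℚring p t pt≡1 using (L)
    open LogarithmOfQuotient ℚring p t pt≡1 using (log-quotient)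

    -- Defined through the ratio of consecutive coefficients, which is just the functional equation
    -- solved for the next coefficient.
    f : Ser
    f zero    = 1ℚ
    f (suc n) = - (pow p n * f n * u n)

    tail-f : Ser
    tail-f zero    = 0ℚ
    tail-f (suc n) = f (suc n)

    h : Ser
    h = log1+ tail-f

    f-equation : σ t f ≋ f ⊕ shift (σ p f)
    f-equation .at zero    = ≡.refl
    f-equation .at (suc n) = begin
      T' * - (P * f n * u n)
        ≡⟨ solve 4 (λ T P f u → T :* :- (P :* f :* u) := :- (P :* f :* u) :+ P :* f :* (u :* (:1 :- T))) ≡.refl T' P (f n) (u n) ⟩
      - (P * f n * u n) + P * f n * (u n * (1ℚ - T'))
        ≡⟨ ≡.cong (λ x → - (P * f n * u n) + P * f n * x) (u-inverse n) ⟩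
      - (P * f n * u n) + P * f n * 1ℚ
        ≡⟨ ≡.cong (λ x → - (P * f n * u n) + x) (*-identityʳ (P * f n)) ⟩
      - (P * f n * u n) + P * f n ∎
      where
      T' = pow t (suc n)
      P = pow p n

    f-value : ∀ n → fSeries n ≃ₜ f n
    f-value n = value (begin
      evalℚ (constₚ (signℚ n)) t                  ≡⟨ evalℚ-const (signℚ n) t ⟩
      signℚ n                                     ≡⟨ cleared-f n ⟩
      f n * (pow t (T n) * evalℚ (qPoch n) t)
        ≡⟨ ≡.cong (f n *_) (≡.trans (evalℚ-* (Xpow (n C 2)) (qPoch n) t)
             (≡.cong (_* evalℚ (qPoch n) t) (≡.trans (evalℚ-Xpow (n C 2) t) (≡.cong (pow t) (C2≡T n))))) ⟨
      f n * evalℚ (Xpow (n C 2) *ₚ qPoch n) t     ∎)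
      where
      cleared-f : ∀ n → signℚ n ≡ f n * (pow t (T n) * evalℚ (qPoch n) t)
      cleared-f zero    = ≡.sym (≡.trans (*-identityˡ _) (≡.trans (*-identityˡ _) (evalℚ-const 1ℚ t)))
      cleared-f (suc n) = ≡.sym (begin
        - (P * f n * u n) * (pow t (n ℕ.+ T n) * evalℚ (qPoch (suc n)) t)
          ≡⟨ ≡.cong₂ (λ x y → - (P * f n * u n) * (x * y)) (pow-+ t n (T n))
               (≡.trans (evalℚ-* (qPoch n) _ t) (≡.cong (Q *_) last-factor)) ⟩
        - (P * f n * u n) * (pow t n * pow t (T n) * (Q * (1ℚ - pow t (suc n))))
          ≡⟨ solve 7 (λ P f u a b Q v → :- (P :* f :* u) :* (a :* b :* (Q :* v)) := :- ((f :* (b :* Q)) :* (P :* a) :* (u :* v)))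
               ≡.refl P (f n) (u n) (pow t n) (pow t (T n)) Q (1ℚ - pow t (suc n)) ⟩
        - (f n * (pow t (T n) * Q) * (P * pow t n) * (u n * (1ℚ - pow t (suc n))))
          ≡⟨ ≡.cong₂ (λ x y → - (x * y)) (≡.cong₂ _*_ (≡.sym (cleared-f n)) (pow-inverse pt≡1 n)) (u-inverse n) ⟩
        - (signℚ n * 1ℚ * 1ℚ)
          ≡⟨ ≡.cong -_ (≡.trans (*-identityʳ _) (*-identityʳ (signℚ n))) ⟩
        - signℚ n ∎)
        where
        P = pow p n
        Q = evalℚ (qPoch n) t
        last-factor : evalℚ (constₚ 1ℚ +ₚ scaleₚ (ℚ.- 1ℚ) (Xpow (suc n))) t ≡ 1ℚ - pow t (suc n)
        last-factor = begin
          evalℚ (constₚ 1ℚ +ₚ scaleₚ (ℚ.- 1ℚ) (Xpow (suc n))) t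
            ≡⟨ evalℚ-+ (constₚ 1ℚ) (scaleₚ (ℚ.- 1ℚ) (Xpow (suc n))) t ⟩
          evalℚ (constₚ 1ℚ) t + evalℚ (scaleₚ (ℚ.- 1ℚ) (Xpow (suc n))) t
            ≡⟨ ≡.cong₂ _+_ (evalℚ-const 1ℚ t) (≡.trans (evalℚ-scale (ℚ.- 1ℚ) (Xpow (suc n)) t)
                 (≡.cong ((- 1ℚ) *_) (evalℚ-Xpow (suc n) t))) ⟩
          1ℚ + (- 1ℚ) * pow t (suc n)
            ≡⟨ solve 1 (λ x → :1 :+ (:- :1) :* x := :1 :- x) ≡.refl (pow t (suc n)) ⟩
          1ℚ - pow t (suc n) ∎

    coefficient-value : ∀ j → (constₚ (signℚ j) ⁄ constₚ (natℚ (suc j))) ≃ₜ (sign j * r j)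
    coefficient-value j = value (begin
      evalℚ (constₚ (signℚ j)) t      ≡⟨ ≡.trans (evalℚ-const (signℚ j) t) (signℚ≡sign j) ⟩
      sign j                          ≡⟨ *-identityʳ (sign j) ⟨
      sign j * 1ℚ                     ≡⟨ ≡.cong (sign j *_) (r-inverse j) ⟨
      sign j * (r j * nat (suc j))    ≡⟨ *-assoc (sign j) (r j) (nat (suc j)) ⟨
      sign j * r j * nat (suc j)      ≡⟨ ≡.cong (sign j * r j *_) (≡.trans (evalℚ-const (natℚ (suc j)) t) (natℚ≡nat (suc j))) ⟨
      sign j * r j * evalℚ (constₚ (natℚ (suc j))) t ∎)

    -- The product is expanded by hand: the series F - 1 is a local definition inside logS and can only be reached by unification.
    h-value : ∀ n → hSeries n ≃ₜ h n
    h-value n = ≃ₜ-sum n (λ j → ≃ₜ-* (coefficient-value j) (≃ₜ-≡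
      (≃ₜ-sum (suc n) {v = λ i → tail-f i * Pow𝕊.pow tail-f j (n ℕ.∸ i)} (λ
        { zero    → ≃ₜ-≡ (≃ₜ-[] ≡.refl) (≡.sym (zeroˡ (Pow𝕊.pow tail-f j n)))
        ; (suc i) → ≃ₜ-* {x = fSeries (suc i)} (f-value (suc i)) (≃ₜ-^ (λ { zero → ≃ₜ-zero ; (suc m) → f-value (suc m) }) j (n ℕ.∸ suc i)) }))
      (≡.sym (antidiagonal≈sum (λ i k → tail-f i * Pow𝕊.pow tail-f j k) n))))

    f-decomposition : f ≋ const 1ℚ ⊕ tail-f
    f-decomposition .at zero    = ≡.refl
    f-decomposition .at (suc n) = ≡.sym (+-identityˡ _)

    D-f : D f ≋ D h ⊛ f
    D-f = 𝕊.sym (𝕊.trans (𝕊.*-congˡ {D h} f-decomposition) (𝕊.trans (D-log1+ tail-f ≡.refl)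
      (pointwise λ { zero → ≡.trans (zeroˡ 0ℚ) (≡.sym (zeroˡ 1ℚ)) ; (suc n) → ≡.refl })))

    h-coefficient : ∀ n → sign n * L (suc n) ≡ nat (suc n) * h (suc n) * (pow t (suc n) - 1ℚ)
    h-coefficient n = ≡.sym (begin
      H * (τ - 1ℚ)
        -- The bracket is assembled to be the left side of `log-quotient` at index `suc n`, which
        -- the next step replaces by `H`.
        ≡⟨ solve 3 (λ H t s → H :* (t :- :1) := (t :* H :+ s) :- H :- s) ≡.refl H τ (pow (- 1ℚ) (suc n) * ℓ) ⟩
      (τ * H + pow (- 1ℚ) (suc n) * ℓ) - H - pow (- 1ℚ) (suc n) * ℓ
        ≡⟨ ≡.cong₂ (λ x y → x - H - y * ℓ) (log-quotient f f-equation ≡.refl (D h) D-f .at (suc n)) (pow-neg1 (suc n)) ⟩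
      H - H - (- sign n) * ℓ
        ≡⟨ solve 3 (λ H s l → H :- H :- (:- s) :* l := s :* l) ≡.refl H (sign n) ℓ ⟩
      sign n * ℓ ∎)
      where
      H = nat (suc n) * h (suc n)
      τ = pow t (suc n)
      ℓ = L (suc n)

    claimed-value : ∀ n → claimedCoeff (toPolyZ (logCarlitz (suc n))) (suc n) ≃ₜ h (suc n)
    claimed-value n = value (begin
      evalℚ (scaleₚ (signℚ n) (toℚPoly (toPolyZ (logCarlitz N)))) t
        ≡⟨ evalℚ-scale (signℚ n) (toℚPoly (toPolyZ (logCarlitz N))) t ⟩
      signℚ n * evalℚ (toℚPoly (toPolyZ (logCarlitz N))) t
        ≡⟨ ≡.cong₂ _*_ (signℚ≡sign n) (evalℚ-toℚPoly (logCarlitz N) t) ⟩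
      sign n * e
        ≡⟨ *-identityʳ (sign n * e) ⟨
      sign n * e * 1ℚ
        ≡⟨ ≡.cong (sign n * e *_) (pow-inverse pt≡1 (T N)) ⟨
      sign n * e * (pow p (T N) * pow t (T N))
        ≡⟨ solve 4 (λ s e a b → s :* e :* (a :* b) := s :* (a :* e) :* b) ≡.refl (sign n) e (pow p (T N)) (pow t (T N)) ⟩
      sign n * L N * pow t (T N)
        ≡⟨ ≡.cong (_* pow t (T N)) (h-coefficient n) ⟩
      nat N * h N * (pow t N - 1ℚ) * pow t (T N)
        ≡⟨ solve 4 (λ k h a b → k :* h :* a :* b := h :* (k :* b :* a)) ≡.refl (nat N) (h N) (pow t N - 1ℚ) (pow t (T N)) ⟩
      h N * (nat N * pow t (T N) * (pow t N - 1ℚ))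
        ≡⟨ ≡.cong (h N *_) denominator ⟨
      h N * evalℚ (scaleₚ (natℚ N) (Xpow (N C 2)) *ₚ (Xpow N +ₚ constₚ (ℚ.- 1ℚ))) t ∎)
      where
      N = suc n
      e = Evaluation.eval ℚring t (logCarlitz N)
      denominator : evalℚ (scaleₚ (natℚ N) (Xpow (N C 2)) *ₚ (Xpow N +ₚ constₚ (ℚ.- 1ℚ))) t
        ≡ nat N * pow t (T N) * (pow t N - 1ℚ)
      denominator = begin
        evalℚ (scaleₚ (natℚ N) (Xpow (N C 2)) *ₚ (Xpow N +ₚ constₚ (ℚ.- 1ℚ))) t
          ≡⟨ evalℚ-* (scaleₚ (natℚ N) (Xpow (N C 2))) (Xpow N +ₚ constₚ (ℚ.- 1ℚ)) t ⟩
        evalℚ (scaleₚ (natℚ N) (Xpow (N C 2))) t * evalℚ (Xpow N +ₚ constₚ (ℚ.- 1ℚ)) t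
          ≡⟨ ≡.cong₂ _*_
               (≡.trans (evalℚ-scale (natℚ N) (Xpow (N C 2)) t)
                 (≡.cong₂ _*_ (natℚ≡nat N) (≡.trans (evalℚ-Xpow (N C 2) t) (≡.cong (pow t) (C2≡T N)))))
               (≡.trans (evalℚ-+ (Xpow N) (constₚ (ℚ.- 1ℚ)) t)
                 (≡.cong₂ _+_ (evalℚ-Xpow N t) (evalℚ-const (ℚ.- 1ℚ) t))) ⟩
        nat N * pow t (T N) * (pow t N - 1ℚ) ∎

  -- Both sides equal `v` times the product of the two denominators at `t`. Since nothing is
  -- divided, the denominators accumulated by `sumF` and `_*F_` need not be shown to be nonzero.
  ≃ₜ-unique : ∀ {x y v} → x ≃ₜ v → y ≃ₜ v → evalℚ (num x *ₚ den y) t ≡ evalℚ (num y *ₚ den x) t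
  ≃ₜ-unique {x} {y} {v} (value e) (value e') = begin
    evalℚ (num x *ₚ den y) t               ≡⟨ evalℚ-* (num x) (den y) t ⟩
    evalℚ (num x) t * b                    ≡⟨ ≡.cong (_* b) e ⟩
    v * a * b                              ≡⟨ solve 3 (λ v a b → v :* a :* b := v :* b :* a) ≡.refl v a b ⟩
    v * b * a                              ≡⟨ ≡.cong (_* a) e' ⟨
    evalℚ (num y) t * a                    ≡⟨ evalℚ-* (num y) (den x) t ⟨
    evalℚ (num y *ₚ den x) t               ∎
    where
    a = evalℚ (den x) t
    b = evalℚ (den y) t

-- From the points q = 2, 3, 4, ... back to ℚ(q)

module _ where
  open CommutativeRing ℚring using (_*_; -_; _-_)
  open DifferenceSolver ℚring
  open PowersAndMultiples ℚring
  open RationalPolynomials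
  open ≡.≡-Reasoning

  pow-nat : ∀ m k → pow (nat m) k ≡ nat (m ℕ.^ k)
  pow-nat m zero    = ≡.refl
  pow-nat m (suc k) = ≡.trans (≡.cong (nat m *_) (pow-nat m k)) (≡.sym (nat-* m (m ℕ.^ k)))

  1-tⁿ≢0 : ∀ {m} → 2 ℕ.≤ m → ∀ n → 1ℚ - pow (nat m) (suc n) ≢ 0ℚ
  1-tⁿ≢0 {m} 2≤m n e = nat-injective-< {1} {m ℕ.^ suc n} (ℕₚ.^-monoʳ-< m 2≤m (s≤s (z≤n {n}))) (begin
    nat (m ℕ.^ suc n) - nat 1          ≡⟨ ≡.cong (_- nat 1) (pow-nat m (suc n)) ⟨
    pow (nat m) (suc n) - nat 1        ≡⟨ solve 1 (λ x → x :- (:1 :+ :0) := :- (:1 :- x)) ≡.refl (pow (nat m) (suc n)) ⟩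
    - (1ℚ - pow (nat m) (suc n))       ≡⟨ ≡.cong -_ e ⟩
    0ℚ                                 ∎)

  inverse : (x : ℚ) → x ≢ 0ℚ → Σ ℚ (λ y → y * x ≡ 1ℚ)
  inverse x x≢0 = (ℚ.1/ x) , ℚₚ.*-inverseˡ x
    where instance _ = ℚ.≢-nonZero x≢0

  hSeries≈claimed : ∀ n → hSeries (suc n) ≈F claimedCoeff (toPolyZ (logCarlitz (suc n))) (suc n)
  -- The points start at 2 because `t` is not invertible at 0 and 1 - tⁿ is not invertible at 1.
  hSeries≈claimed n = agreeing (num x *ₚ den y) (num y *ₚ den x) 2 at-m
    where
    x = hSeries (suc n)
    y = claimedCoeff (toPolyZ (logCarlitz (suc n))) (suc n)
    at-m : ∀ m → 2 ℕ.≤ m → evalℚ (num x *ₚ den y) (nat m) ≡ evalℚ (num y *ₚ den x) (nat m)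
    at-m m@(suc m') 2≤m = ≃ₜ-unique (h-value r (λ j → proj₂ (r-inv j)) u (λ j → proj₂ (u-inv j)) (proj₁ p-inv) (proj₂ p-inv) (suc n))
        (claimed-value r (λ j → proj₂ (r-inv j)) u (λ j → proj₂ (u-inv j)) (proj₁ p-inv) (proj₂ p-inv) n)
      where
      open Specialisation (nat m)
      r-inv = λ j → inverse (nat (suc j)) (nat-suc≢0 j)
      u-inv = λ j → inverse (1ℚ - pow (nat m) (suc j)) (1-tⁿ≢0 2≤m j)
      p-inv = inverse (nat m) (nat-suc≢0 m')
      r = λ j → proj₁ (r-inv j)
      u = λ j → proj₁ (u-inv j)

open import Data.Nat using (_*_; _∸_; _≤_)

theorem2p7 : Σ (ℕ → PolyZ) (λ P →
    (∀ n → 1 ≤ n → hSeries n ≈F claimedCoeff (P n) n)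
    × (∀ n → 1 ≤ n → HasDegree (P n) (n C 2))
    × (∀ d n → 1 ≤ d → 1 ≤ n → (R : CommutativeRing 0ℓ 0ℓ) →
    IsCharZeroDomain R → (ω : CommutativeRing.Carrier R) →
    IsPrimitiveRoot R d ω →
    CommutativeRing._≈_ R (evalZ R (P (d * n)) ω)
    (natR R ((2 * n ∸ 1) C (n ∸ 1)))))
theorem2p7 =
    (λ n → toPolyZ (logCarlitz n))
  , (λ { (suc n) _ → hSeries≈claimed n })
  , logCarlitz-degree
  , (λ { (suc d) (suc k) _ _ R domain ω ω-primitive →
         PrimitiveRootValue.logCarlitz-at-root R domain d ω ω-primitive k })
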